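{- Let $q\ge5$ be odd. The $\mathrm{U}\Gamma$-lines (non-tangent unisecants of the twisted cubic $\mathcal{C}$ lying in an osculating plane) form one orbit under $G_q$. The subgroup of $G_q$ fixing a $\mathrm{U}\Gamma$-line has size $q-1$. For the $\mathrm{U}\Gamma$-line $\ell$ through $P_0=P(0,0,0,1)$ and $P(0,1,0,0)$, every element of the subgroup of $G_q$ fixing $\ell$ has a matrix of the form $\begin{pmatrix}1&0&0&0\\0&d&0&0\\0&0&d^2&0\\0&0&0&d^3\end{pmatrix}$, $d\in\mathbb{F}_q^*$.
   Context: $\mathrm{PG}(3,q)$ has points $P(x_0,x_1,x_2,x_3)$; $\boldsymbol{\pi}(c_0,c_1,c_2,c_3)$ is the plane $c_0x_0+c_1x_1+c_2x_2+c_3x_3=0$. For $t\in\mathbb{F}_q$ let $P_t=P(t^3,t^2,t,1)$, $P_\infty=P(1,0,0,0)$; the twisted cubic is $\mathcal{C}=\{P_t\}$. The osculating planes are $\pi_{\mathrm{osc}}(t)=\boldsymbol{\pi}(1,-3t,3t^2,-t^3)$ ($t\in\mathbb{F}_q$), $\pi_{\mathrm{osc}}(\infty)=\boldsymbol{\pi}(0,0,0,1)$. The tangent at $P_t$ ($t\in\mathbb{F}_q$) is the line through $P_t$ and $P(3t^2,2t,1,0)$; the tangent at $P_\infty$ is $x_2=x_3=0$. A $\mathrm{U}\Gamma$-line is a line meeting $\mathcal{C}$ in exactly one point, not a tangent, contained in an osculating plane. $G_q$ is the group of projectivities mapping $\mathcal{C}$ to itself; for $q\ge5$ its elements are $x\mapsto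 xM$ on row vectors, $M=\begin{pmatrix} a^3&a^2c&ac^2&c^3\\ 3a^2b&a^2d+2abc&bc^2+2acd&3c^2d\\ 3ab^2&b^2c+2abd&ad^2+2bcd&3cd^2\\ b^3&b^2d&bd^2&d^3\end{pmatrix}$, $ad-bc\ne0$, up to scalar. -}

module Defs where

open import Algebra.Bundles using (CommutativeRing; Semiring)
import Algebra.Definitions.RawSemiring as RawSemiringDefinitions
open import Data.Fin.Base using (Fin)
open import Data.Fin.Patterns using (0F; 1F; 2F; 3F)
open import Data.Nat.Base using (ℕ)
open import Data.Product.Base using (Σ; ∃-syntax; _×_; _,_; proj₁)
open import Data.Vec.Functional using (Vector; []; _∷_)
import Data.Vec.Functional.Relation.Binary.Equality.Setoid as VectorEquality
open import Function.Bundles using (Inverse; _⇔_)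
open import Level using (Level; Lift; _⊔_; suc)
open import Relation.Binary.Bundles using (Setoid)
import Relation.Binary.PropositionalEquality as ≡
open import Relation.Nullary.Negation using (¬_)
open import Relation.Unary using (Pred; _∈_; _⊆_; _≐_)

HasSize : ∀ {a ℓ} → Setoid a ℓ → ℕ → Set (a ⊔ ℓ)
HasSize S n = Inverse S (≡.setoid (Fin n))

record FiniteField (c ℓ : Level) (q : ℕ) : Set (suc (c ⊔ ℓ)) where
  field
    commutativeRing : CommutativeRing c ℓ
  open CommutativeRing commutativeRing public
  field
    1≉0     : 1# ≉ 0#
    inverse : ∀ x → x ≉ 0# → ∃[ y ] x * y ≈ 1#
    size    : HasSize setoid q

module ProjectiveSpace {c ℓ : Level} {q : ℕ} (F : FiniteField c ℓ q) where

  open FiniteField F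
  open RawSemiringDefinitions (Semiring.rawSemiring semiring) public
    using (_^_; sum) renaming (_×_ to _·_)
  open VectorEquality setoid using (_≋_)

  Coords : Set c
  Coords = Vector Carrier 4

  Matrix : Set c
  Matrix = Vector Coords 4

  𝟎 : Coords
  𝟎 _ = 0#

  infixl 7 _⋆_

  _⋆_ : Coords → Matrix → Coords
  (x ⋆ M) j = sum (λ i → x i * M i j)

  record Point : Set (c ⊔ ℓ) where
    constructor P
    field
      coords  : Coords
      nonzero : ¬ (coords ≋ 𝟎)
  open Point public

  infix 4 _∼_ _∼ᴹ_

  _∼_ : Point → Point → Set (c ⊔ ℓ)
  p ∼ r = ∃[ k ] k ≉ 0# × (∀ i → coords p i ≈ k * coords r i)

  _∼ᴹ_ : Matrix → Matrix → Set (c ⊔ ℓ)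
  M ∼ᴹ N = ∃[ k ] k ≉ 0# × (∀ i j → M i j ≈ k * N i j)

  π : Coords → Pred Point ℓ
  π a p = sum (λ i → a i * coords p i) ≈ 0#

  join : Point → Point → Pred Point (c ⊔ ℓ)
  join p r s = ∃[ a ] ∃[ b ] (∀ i → coords s i ≈ a * coords p i + b * coords r i)

  record Line : Set (c ⊔ ℓ) where
    constructor line
    field
      p₁ p₂    : Point
      distinct : ¬ (p₁ ∼ p₂)

  ⟦_⟧ : Line → Pred Point (c ⊔ ℓ)
  ⟦ line p r _ ⟧ = join p r

  -- A projectivity is represented by an invertible matrix; two matrices represent
  -- the same one when related by _∼ᴹ_. Invertibility is stated through the action
  -- on row vectors.
  record Projectivity : Set (c ⊔ ℓ) where
    field
      matrix   : Matrix
      matrix⁻¹ : Matrix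
      leftInv  : ∀ x → x ⋆ matrix ⋆ matrix⁻¹ ≋ x
      rightInv : ∀ x → x ⋆ matrix⁻¹ ⋆ matrix ≋ x
  open Projectivity public

  private
    ⋆-congˡ : ∀ {x y} M → x ≋ y → x ⋆ M ≋ y ⋆ M
    ⋆-congˡ M x≋y j =
      +-cong (*-congʳ (x≋y 0F)) (+-cong (*-congʳ (x≋y 1F))
        (+-cong (*-congʳ (x≋y 2F)) (+-congʳ (*-congʳ (x≋y 3F)))))

    0+ : ∀ {x y} → x ≈ 0# → y ≈ 0# → x + y ≈ 0#
    0+ x≈0 y≈0 = trans (+-cong x≈0 y≈0) (+-identityˡ 0#)

    𝟎⋆ : ∀ M → 𝟎 ⋆ M ≋ 𝟎
    𝟎⋆ M j = 0+ (zeroˡ _) (0+ (zeroˡ _) (0+ (zeroˡ _) (0+ (zeroˡ _) refl)))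

  apply : Projectivity → Point → Point
  apply g (P x x≉0) = P (x ⋆ matrix g) λ xM≋0 → x≉0 λ i →
    trans (sym (leftInv g x i))
      (trans (⋆-congˡ (matrix⁻¹ g) xM≋0 i) (𝟎⋆ (matrix⁻¹ g) i))

  image : Projectivity → Pred Point (c ⊔ ℓ) → Pred Point (c ⊔ ℓ)
  image g S r = ∃[ p ] p ∈ S × r ∼ apply g p

  ∼ᴹ-refl : ∀ {M} → M ∼ᴹ M
  ∼ᴹ-refl = 1# , 1≉0 , λ i j → sym (*-identityˡ _)

  ∼ᴹ-sym : ∀ {M N} → M ∼ᴹ N → N ∼ᴹ M
  ∼ᴹ-sym (k , k≉0 , M≈kN) with inverse k k≉0
  ... | k⁻¹ , kk⁻¹≈1 =
    k⁻¹ ,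
    (λ k⁻¹≈0 → 1≉0 (trans (sym kk⁻¹≈1) (trans (*-congˡ k⁻¹≈0) (zeroʳ k)))) ,
    λ i j → trans (sym (*-identityˡ _))
      (trans (*-congʳ (trans (sym kk⁻¹≈1) (*-comm k k⁻¹)))
        (trans (*-assoc k⁻¹ k _) (*-congˡ (sym (M≈kN i j)))))

  ∼ᴹ-trans : ∀ {L M N} → L ∼ᴹ M → M ∼ᴹ N → L ∼ᴹ N
  ∼ᴹ-trans (k , k≉0 , L≈kM) (m , m≉0 , M≈mN) with inverse k k≉0
  ... | k⁻¹ , kk⁻¹≈1 =
    k * m ,
    (λ km≈0 → m≉0
      (trans (sym (*-identityˡ m))
        (trans (*-congʳ (trans (sym kk⁻¹≈1) (*-comm k k⁻¹)))
          (trans (*-assoc k⁻¹ k m) (trans (*-congˡ km≈0) (zeroʳ k⁻¹)))))) ,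
    λ i j → trans (L≈kM i j)
      (trans (*-congˡ (M≈mN i j)) (sym (*-assoc k m _)))

module TwistedCubic {c ℓ : Level} {q : ℕ} (F : FiniteField c ℓ q) where

  open FiniteField F
  open ProjectiveSpace F public

  data Parameter : Set c where
    fin : Carrier → Parameter
    ∞   : Parameter

  cubicPoint : Parameter → Point
  cubicPoint (fin t) = P (t ^ 3 ∷ t ^ 2 ∷ t ∷ 1# ∷ []) λ h → 1≉0 (h 3F)
  cubicPoint ∞       = P (1# ∷ 0# ∷ 0# ∷ 0# ∷ []) λ h → 1≉0 (h 0F)

  𝒞 : Pred Point (c ⊔ ℓ)
  𝒞 p = ∃[ t ] p ∼ cubicPoint t

  π-osc : Parameter → Pred Point ℓ
  π-osc (fin t) = π (1# ∷ - (3 · t) ∷ 3 · t ^ 2 ∷ - (t ^ 3) ∷ [])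
  π-osc ∞       = π (0# ∷ 0# ∷ 0# ∷ 1# ∷ [])

  tangentDirection : Carrier → Point
  tangentDirection t = P (3 · t ^ 2 ∷ 2 · t ∷ 1# ∷ 0# ∷ []) λ h → 1≉0 (h 2F)

  tangent : Parameter → Pred Point (c ⊔ ℓ)
  tangent (fin t) = join (cubicPoint (fin t)) (tangentDirection t)
  tangent ∞       = λ p → Lift c (coords p 2F ≈ 0# × coords p 3F ≈ 0#)

  IsTangent : Pred Line (c ⊔ ℓ)
  IsTangent l = ∃[ t ] ⟦ l ⟧ ≐ tangent t

  Unisecant : Pred Line (c ⊔ ℓ)
  Unisecant l = ∃[ p ] (p ∈ 𝒞 × p ∈ ⟦ l ⟧) × (∀ r → r ∈ 𝒞 → r ∈ ⟦ l ⟧ → r ∼ p)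

  UΓ : Pred Line (c ⊔ ℓ)
  UΓ l = Unisecant l × ¬ IsTangent l × ∃[ t ] ⟦ l ⟧ ⊆ π-osc t

  G : Set (c ⊔ ℓ)
  G = Σ Projectivity λ g → image g 𝒞 ≐ 𝒞

  Maps : G → Line → Line → Set (c ⊔ ℓ)
  Maps (g , _) l m = image g ⟦ l ⟧ ≐ ⟦ m ⟧

  Fixes : G → Pred Line (c ⊔ ℓ)
  Fixes g l = Maps g l l

  IsOrbit : Pred Line (c ⊔ ℓ) → Set (c ⊔ ℓ)
  IsOrbit S = ∃[ l ] (∀ m → m ∈ S ⇔ (∃[ g ] Maps g l m))

  stabiliser : Line → Setoid (c ⊔ ℓ) (c ⊔ ℓ)
  stabiliser l = record
    { Carrier       = Σ G λ g → Fixes g l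
    ; _≈_           = λ (g , _) (h , _) → matrix (proj₁ g) ∼ᴹ matrix (proj₁ h)
    ; isEquivalence = record { refl = ∼ᴹ-refl ; sym = ∼ᴹ-sym ; trans = ∼ᴹ-trans }
    }

  ℓ₀ : Line
  ℓ₀ = line
    (P (0# ∷ 0# ∷ 0# ∷ 1# ∷ []) λ h → 1≉0 (h 3F))
    (P (0# ∷ 1# ∷ 0# ∷ 0# ∷ []) λ h → 1≉0 (h 1F))
    λ (k , _ , h) → 1≉0 (trans (h 3F) (zeroʳ k))

  diagonal : Carrier → Matrix
  diagonal d =
    (1# ∷ 0# ∷ 0#    ∷ 0#    ∷ []) ∷
    (0# ∷ d  ∷ 0#    ∷ 0#    ∷ []) ∷
    (0# ∷ 0# ∷ d ^ 2 ∷ 0#    ∷ []) ∷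
    (0# ∷ 0# ∷ 0#    ∷ d ^ 3 ∷ []) ∷ []

module Submission where

-- A group element of G mapping P₀ to P_t and P_∞ to another point of the cubic agrees at
-- P₀ and P_∞ with a product K of two explicit elements: a conjugate U of a translation,
-- fixing P₀, followed by the translation by t (or the reversal of coordinates if t = ∞).
-- What remains is an element fixing P₀ and P_∞; the quadrics x₀x₂ = x₁² and x₁x₃ = x₂²
-- containing the cubic, together with q - 1 ≥ 4, force its matrix to be diagonal. Hence
-- every element of G is a diagonal matrix times some K. The diagonal ones fix ℓ₀, and
-- as 2 ≠ 0 the images of ℓ₀ under the K are exactly the UΓ-lines, while K fixes ℓ₀ only
-- if it is trivial. The stabiliser of any other UΓ-line is conjugate to that of ℓ₀.

open import Algebra.Bundles using (CommutativeRing; Group)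
open import Algebra.Bundles.Raw using (RawRing)
open import Data.Fin.Base as Fin using (Fin; punchIn; punchOut)
open import Data.Fin.Patterns using (0F; 1F; 2F; 3F)
import Data.Fin.Properties as Fin
open import Data.Nat.Base using (ℕ; zero; suc; _≤_; _∸_; s≤s)
open import Data.Nat.Divisibility using (_∣_)
open import Data.Product.Base using (Σ; _×_; ∃-syntax; _,_; proj₁; proj₂)
import Data.Vec.Functional.Relation.Binary.Equality.Setoid as VectorEquality
open import Function.Base using (_∘_; _$_; case_of_)
open import Function.Bundles using (Inverse; mk⇔)
import Function.Construct.Composition as Composition
open import Level using (Level; _⊔_)
open import Relation.Binary.Bundles using (Setoid)
open import Relation.Binary.Definitions using (Decidable; _Respects_)
open import Relation.Binary.PropositionalEquality as ≡ using (_≡_; _≢_)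
open import Relation.Nullary.Decidable.Core using (yes; no; map′)
open import Relation.Nullary.Negation using (¬_; contradiction)
open import Relation.Unary using (Pred; _∈_; _⊆_; _≐_)
open import Relation.Unary.Properties using (≐-refl; ≐-sym; ≐-trans)
open import Defs

-- `G` is defined as all projectivities that preserve the cubic, so a matrix form for its elements
-- has to be derived. The bound 4 on the number of units is the number of coefficients of a cubic
-- polynomial: four distinct roots annihilate it. The geometry is transported to P₀, whose
-- osculating plane is x₀ = 0 and whose tangent is x₀ = x₁ = 0. An osculating plane meets the cubic
-- only at its contact point, so a UΓ-line in the plane at P₀ passes through P₀, and, not being the
-- tangent, joins P₀ to some (0, 1, s, 0). Since `U c` sends (0, 1, 0, 0) to (0, 1, 2c, 3c²) and
-- fixes P₀, it sends `ℓ₀` to the line with s = 2c. Both uses of 2 ≠ 0 come from this formula: 2c =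
-- s is solvable for every s, which gives transitivity, and 2c = 0 forces c = 0, which removes `U c`
-- from the stabiliser of `ℓ₀`.

-- A ring solver with integer coefficients.

module IntegerCoefficients {c ℓ} (R : CommutativeRing c ℓ) where

  open CommutativeRing R
  open import Algebra.Properties.AbelianGroup +-abelianGroup
    using (ε⁻¹≈ε; ⁻¹-involutive; ⁻¹-∙-comm)
  open import Algebra.Properties.Ring ring using (-‿distribˡ-*; -‿distribʳ-*)
  open import Algebra.Properties.Semiring.Mult.TCOptimised semiring
    using (×1-homo-*; ×-homo-+; 1+×) renaming (_×_ to _·_)
  open import Algebra.Solver.Ring.AlmostCommutativeRing
    using (fromCommutativeRing; _-Raw-AlmostCommutative⟶_)
  open import Data.Integer.Base as ℤ using (ℤ; +_; -[1+_]; _⊖_; _◃_)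
  import Data.Integer.Properties as ℤ
  open import Data.Maybe.Base using (Maybe; just; nothing)
  import Data.Nat.Base as Nat
  open import Data.Nat.Properties using (+-suc)
  import Data.Sign.Base as Sign
  open import Relation.Binary.Reasoning.Setoid setoid

  private
    -- With this form of multiple, `0 · 1#` and `1 · 1#` compute to `0#` and `1#`, so `con (+ 0)`
    -- and `con (+ 1)` denote literally the constants that occur in goals.
    ⟦_⟧ᶻ : ℤ → Carrier
    ⟦ + n      ⟧ᶻ = n · 1#
    ⟦ -[1+ n ] ⟧ᶻ = - (suc n · 1#)

    ⊖-homo : ∀ m n → ⟦ m ⊖ n ⟧ᶻ ≈ m · 1# - n · 1#
    ⊖-homo zero    zero    = sym (-‿inverseʳ 0#)
    ⊖-homo zero    (suc n) = sym (+-identityˡ _)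
    ⊖-homo (suc m) zero    = sym (trans (+-congˡ ε⁻¹≈ε) (+-identityʳ _))
    ⊖-homo (suc m) (suc n) = begin
      ⟦ suc m ⊖ suc n ⟧ᶻ                    ≡⟨ ≡.cong ⟦_⟧ᶻ (ℤ.[1+m]⊖[1+n]≡m⊖n m n) ⟩
      ⟦ m ⊖ n ⟧ᶻ                            ≈⟨ ⊖-homo m n ⟩
      m · 1# - n · 1#                       ≈⟨ +-congʳ (+-identityʳ _) ⟨
      (m · 1# + 0#) - n · 1#                ≈⟨ +-congʳ (+-congˡ (-‿inverseʳ 1#)) ⟨
      (m · 1# + (1# - 1#)) - n · 1#         ≈⟨ +-congʳ (+-assoc _ _ _) ⟨
      ((m · 1# + 1#) - 1#) - n · 1#         ≈⟨ +-congʳ (+-congʳ (+-comm _ _)) ⟩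
      ((1# + m · 1#) - 1#) - n · 1#         ≈⟨ +-assoc _ _ _ ⟩
      (1# + m · 1#) + (- 1# - n · 1#)       ≈⟨ +-congˡ (⁻¹-∙-comm _ _) ⟩
      (1# + m · 1#) - (1# + n · 1#)         ≈⟨ +-cong (1+× m 1#) (-‿cong (1+× n 1#)) ⟨
      suc m · 1# - suc n · 1#               ∎

    neg-homo : ∀ i → ⟦ ℤ.- i ⟧ᶻ ≈ - ⟦ i ⟧ᶻ
    neg-homo (+ zero)  = sym ε⁻¹≈ε
    neg-homo (+ suc n) = refl
    neg-homo -[1+ n ]  = sym (⁻¹-involutive _)

    +-homo : ∀ i j → ⟦ i ℤ.+ j ⟧ᶻ ≈ ⟦ i ⟧ᶻ + ⟦ j ⟧ᶻ
    +-homo (+ m)      (+ n)      = ×-homo-+ 1# m n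
    +-homo (+ m)      -[1+ n ]   = ⊖-homo m (suc n)
    +-homo -[1+ m ]   (+ n)      = trans (⊖-homo n (suc m)) (+-comm _ _)
    +-homo -[1+ m ]   -[1+ n ]   = begin
      - (suc (suc (m Nat.+ n)) · 1#)         ≡⟨ ≡.cong (λ k → - (suc k · 1#)) (≡.sym (+-suc m n)) ⟩
      - ((suc m Nat.+ suc n) · 1#)           ≈⟨ -‿cong (×-homo-+ 1# (suc m) (suc n)) ⟩
      - (suc m · 1# + suc n · 1#)          ≈⟨ ⁻¹-∙-comm _ _ ⟨
      - (suc m · 1#) - suc n · 1#          ∎

    -◃-homo : ∀ n → ⟦ Sign.- ◃ n ⟧ᶻ ≈ - (n · 1#)
    -◃-homo zero    = sym ε⁻¹≈ε
    -◃-homo (suc n) = refl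

    +◃-homo : ∀ n → ⟦ Sign.+ ◃ n ⟧ᶻ ≈ n · 1#
    +◃-homo zero    = refl
    +◃-homo (suc n) = refl

    *-homo : ∀ i j → ⟦ i ℤ.* j ⟧ᶻ ≈ ⟦ i ⟧ᶻ * ⟦ j ⟧ᶻ
    *-homo (+ m)    (+ n)    = trans (+◃-homo (m Nat.* n)) (×1-homo-* m n)
    *-homo (+ m)    -[1+ n ] =
      trans (-◃-homo (m Nat.* suc n)) (trans (-‿cong (×1-homo-* m (suc n))) (-‿distribʳ-* _ _))
    *-homo -[1+ m ] (+ n)    =
      trans (-◃-homo (suc m Nat.* n)) (trans (-‿cong (×1-homo-* (suc m) n)) (-‿distribˡ-* _ _))
    *-homo -[1+ m ] -[1+ n ] = begin
      (suc m Nat.* suc n) · 1#               ≈⟨ ×1-homo-* (suc m) (suc n) ⟩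
      suc m · 1# * suc n · 1#              ≈⟨ ⁻¹-involutive _ ⟨
      - - (suc m · 1# * suc n · 1#)        ≈⟨ -‿cong (-‿distribˡ-* _ _) ⟩
      - (- (suc m · 1#) * suc n · 1#)      ≈⟨ -‿distribʳ-* _ _ ⟩
      - (suc m · 1#) * - (suc n · 1#)      ∎

    morphism : ℤ.+-*-rawRing -Raw-AlmostCommutative⟶ fromCommutativeRing R
    morphism = record
      { ⟦_⟧    = ⟦_⟧ᶻ
      ; +-homo = +-homo
      ; *-homo = *-homo
      ; -‿homo = neg-homo
      ; 0-homo = refl
      ; 1-homo = refl
      }

    -- Distinct integers may become equal in `R`, so a difference gives no verdict; the solver then
    -- proves identities that already hold over the integers.
    _≟_ : ∀ i j → Maybe (⟦ i ⟧ᶻ ≈ ⟦ j ⟧ᶻ)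
    i ≟ j with i ℤ.≟ j
    ... | yes i≡j = just (reflexive (≡.cong ⟦_⟧ᶻ i≡j))
    ... | no  _   = nothing

  open import Algebra.Solver.Ring ℤ.+-*-rawRing (fromCommutativeRing R) morphism _≟_ public
    using (solve; _:=_; _:+_; _:*_; _:-_; :-_; _:^_; con; Polynomial)

-- Parity of a set with a fixed-point-free involution.

module FixedPointFreeInvolution where

  open import Data.Fin.Permutation using (permutation)
  open import Data.Nat.Base using (_+_; _*_)
  open import Data.Nat.Divisibility using (divides)
  open import Data.Nat.Properties using (+-0-commutativeMonoid; +-identityʳ; *-comm)
  open import Algebra.Properties.CommutativeMonoid.Sum +-0-commutativeMonoid
    using (sum; sum-cong-≗; sum-permute; ∑-distrib-+)
  open import Relation.Binary.Definitions using (tri<; tri≈; tri>)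
  open ≡.≡-Reasoning

  private
    sum-1 : ∀ n → sum {n} (λ _ → 1) ≡ n
    sum-1 zero    = ≡.refl
    sum-1 (suc n) = ≡.cong suc (sum-1 n)

    -- Selects the smaller element of each two-element orbit.
    below : ∀ {n} → Fin n → Fin n → ℕ
    below i j with i Fin.<? j
    ... | yes _ = 1
    ... | no  _ = 0

    below-swap : ∀ {n} (i j : Fin n) → i ≢ j → below i j + below j i ≡ 1
    below-swap i j i≢j with i Fin.<? j | j Fin.<? i
    ... | yes i<j | yes j<i = contradiction j<i (Fin.<-asym i<j)
    ... | yes _   | no  _   = ≡.refl
    ... | no  _   | yes _   = ≡.refl
    ... | no  i≮j | no  j≮i with Fin.<-cmp i j
    ...   | tri< i<j _ _ = contradiction i<j i≮j
    ...   | tri≈ _ i≡j _ = contradiction i≡j i≢j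
    ...   | tri> _ _ j<i = contradiction j<i j≮i

  -- Exactly one of i and f i is the smaller, so the constant 1 splits as χ i + χ (f i). The two
  -- summands have the same total, since f permutes the indices.
  even-size : ∀ {n} (f : Fin n → Fin n) → (∀ i → f (f i) ≡ i) → (∀ i → f i ≢ i) → 2 ∣ n
  even-size {n} f f∘f≗id f-free = divides s $ begin
    n                                    ≡⟨ sum-1 n ⟨
    sum {n} (λ _ → 1)                    ≡⟨ sum-cong-≗ (λ i → below-swap i (f i) (f-free i ∘ ≡.sym)) ⟨
    sum (λ i → χ i + below (f i) i)      ≡⟨ sum-cong-≗ (λ i → ≡.cong (λ j → χ i + below (f i) j)
                                                           (f∘f≗id i)) ⟨
    sum (λ i → χ i + χ (f i))            ≡⟨ ∑-distrib-+ χ (χ ∘ f) ⟩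
    s + sum (χ ∘ f)                      ≡⟨ ≡.cong (s +_) (sum-permute χ
                                              (permutation f f f∘f≗id f∘f≗id)) ⟨
    s + s                                ≡⟨ ≡.cong (s +_) (+-identityʳ s) ⟨
    s + (s + 0)                          ≡⟨ *-comm 2 s ⟩
    s * 2                                ∎
    where
    χ : Fin n → ℕ
    χ i = below i (f i)
    s = sum χ

-- Finite fields: cancellation, characteristic, units.

module FieldProperties {c ℓ : Level} {n : ℕ} (F : FiniteField c ℓ (suc n)) where

  open FiniteField F
  open IntegerCoefficients commutativeRing
  open import Data.Vec.Base using (Vec; []; _∷_)
  open import Data.Vec.Relation.Unary.All using (All; []; _∷_)
  open import Data.Vec.Relation.Unary.AllPairs using (AllPairs; []; _∷_)
  open import Data.Integer.Base using (+_)
  open import Algebra.Properties.AbelianGroup +-abelianGroup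
    using (∙-cancelˡ; x∙y⁻¹≈ε⇒x≈y)
  open import Relation.Binary.Reasoning.Setoid setoid
  private module Size = Inverse size

  to-injective : ∀ {x y} → Size.to x ≡ Size.to y → x ≈ y
  to-injective eq = trans (sym (Size.inverseʳ ≡.refl)) (Size.inverseʳ eq)

  infix 4 _≈?_
  _≈?_ : Decidable _≈_
  x ≈? y = map′ to-injective Size.to-cong (Size.to x Fin.≟ Size.to y)

  *-cancelˡ-≉0 : ∀ {x y z} → x ≉ 0# → x * y ≈ x * z → y ≈ z
  *-cancelˡ-≉0 {x} {y} {z} x≉0 xy≈xz = let x⁻¹ , xx⁻¹≈1 = inverse x x≉0 in begin
    y                ≈⟨ *-identityˡ y ⟨
    1# * y           ≈⟨ *-congʳ xx⁻¹≈1 ⟨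
    x * x⁻¹ * y      ≈⟨ solve 3 (λ x x⁻¹ y → x :* x⁻¹ :* y := x⁻¹ :* (x :* y)) refl x x⁻¹ y ⟩
    x⁻¹ * (x * y)    ≈⟨ *-congˡ xy≈xz ⟩
    x⁻¹ * (x * z)    ≈⟨ solve 3 (λ x x⁻¹ y → x :* x⁻¹ :* y := x⁻¹ :* (x :* y)) refl x x⁻¹ z ⟨
    x * x⁻¹ * z      ≈⟨ *-congʳ xx⁻¹≈1 ⟩
    1# * z           ≈⟨ *-identityˡ z ⟩
    z                ∎

  x≉0∧xy≈0⇒y≈0 : ∀ {x y} → x ≉ 0# → x * y ≈ 0# → y ≈ 0#
  x≉0∧xy≈0⇒y≈0 x≉0 xy≈0 = *-cancelˡ-≉0 x≉0 (trans xy≈0 (sym (zeroʳ _)))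

  xy≈0∧y≉0⇒x≈0 : ∀ {x y} → x * y ≈ 0# → y ≉ 0# → x ≈ 0#
  xy≈0∧y≉0⇒x≈0 xy≈0 y≉0 = x≉0∧xy≈0⇒y≈0 y≉0 (trans (*-comm _ _) xy≈0)

  *-≉0 : ∀ {x y} → x ≉ 0# → y ≉ 0# → x * y ≉ 0#
  *-≉0 x≉0 y≉0 = y≉0 ∘ x≉0∧xy≈0⇒y≈0 x≉0

  inverse-≉0 : ∀ {x y} → x * y ≈ 1# → y ≉ 0#
  inverse-≉0 xy≈1 y≈0 = 1≉0 (trans (sym xy≈1) (trans (*-congˡ y≈0) (zeroʳ _)))

  -- In characteristic 2 the map x ↦ x + 1 would be a fixed-point-free involution of the field,
  -- whose size would then be even.
  1+1≉0 : ¬ (2 ∣ suc n) → 1# + 1# ≉ 0#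
  1+1≉0 q-odd 1+1≈0 = q-odd (FixedPointFreeInvolution.even-size f f-involutive f-free)
    where
    f : Fin (suc n) → Fin (suc n)
    f i = Size.to (Size.from i + 1#)

    f-involutive : ∀ i → f (f i) ≡ i
    f-involutive i = Size.inverseˡ $ begin
      Size.from (f i) + 1#         ≈⟨ +-congʳ (Size.inverseʳ ≡.refl) ⟩
      (Size.from i + 1#) + 1#      ≈⟨ +-assoc _ _ _ ⟩
      Size.from i + (1# + 1#)      ≈⟨ +-congˡ 1+1≈0 ⟩
      Size.from i + 0#             ≈⟨ +-identityʳ _ ⟩
      Size.from i                  ∎

    f-free : ∀ i → f i ≢ i
    f-free i fi≡i = 1≉0 $ ∙-cancelˡ (Size.from i) 1# 0# $ begin
      Size.from i + 1#             ≈⟨ Size.inverseʳ (≡.sym fi≡i) ⟨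
      Size.from i                  ≈⟨ +-identityʳ _ ⟨
      Size.from i + 0#             ∎

  Units : Setoid (c ⊔ ℓ) ℓ
  Units = record
    { Carrier       = ∃[ x ] x ≉ 0#
    ; _≈_           = λ (x , _) (y , _) → x ≈ y
    ; isEquivalence = record { refl = refl ; sym = sym ; trans = trans }
    }

  -- Deleting the index of `0#` from the enumeration of the field leaves one index for each unit.
  units-size : HasSize Units n
  units-size = record
    { to        = λ (x , x≉0) → punchOut (x≉0 ∘ sym ∘ to-injective)
    ; from      = λ i → Size.from (punchIn z i) , λ eq → Fin.punchInᵢ≢i z i (≡.sym (from≈0⇒z≡i eq))
    ; to-cong   = λ x≈y → Fin.punchOut-cong z (Size.to-cong x≈y)
    ; from-cong = λ i≡j → Size.from-cong (≡.cong (punchIn z) i≡j)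
    ; inverse   =
      (λ eq → ≡.trans (Fin.punchOut-cong z (Size.inverseˡ eq)) (Fin.punchOut-punchIn z)) ,
      (λ { ≡.refl → Size.inverseʳ (Fin.punchIn-punchOut _) })
    }
    where
    z = Size.to 0#

    from≈0⇒z≡i : ∀ {i} → Size.from i ≈ 0# → z ≡ i
    from≈0⇒z≡i eq = Size.inverseˡ (sym eq)

  -- Polynomials with as many roots as coefficients.

  -- Horner's scheme, constant term first: a vector of length m is a polynomial of degree less than
  -- m.
  eval : ∀ {m} → Vec Carrier m → Carrier → Carrier
  eval []      x = 0#
  eval (a ∷ p) x = a + x * eval p x

  private
    -- Synthetic division by x - r: the coefficients are the Horner values at r of the proper tails
    -- of the polynomial.
    quotient : ∀ {m} → Vec Carrier (suc m) → Carrier → Vec Carrier m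
    quotient (a ∷ [])    r = []
    quotient (a ∷ b ∷ p) r = eval (b ∷ p) r ∷ quotient (b ∷ p) r

    eval-quotient : ∀ {m} (p : Vec Carrier (suc m)) r x →
                    eval p x ≈ (x - r) * eval (quotient p r) x + eval p r
    eval-quotient (a ∷ [])    r x =
      solve 3 (λ a r x → a :+ x :* con (+ 0) := (x :- r) :* con (+ 0) :+ (a :+ r :* con (+ 0)))
        refl a r x
    eval-quotient (a ∷ b ∷ p) r x = begin
      a + x * eval (b ∷ p) x
        ≈⟨ +-congˡ (*-congˡ (eval-quotient (b ∷ p) r x)) ⟩
      a + x * ((x - r) * eval (quotient (b ∷ p) r) x + eval (b ∷ p) r)
        ≈⟨ solve 5 (λ a r x q e → a :+ x :* ((x :- r) :* q :+ e) :=
                                  (x :- r) :* (e :+ x :* q) :+ (a :+ r :* e))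
             refl a r x (eval (quotient (b ∷ p) r) x) (eval (b ∷ p) r) ⟩
      (x - r) * (eval (b ∷ p) r + x * eval (quotient (b ∷ p) r) x) + (a + r * eval (b ∷ p) r) ∎

    root-of-zero : ∀ {a r e} → e ≈ 0# → a + r * e ≈ 0# → a ≈ 0#
    root-of-zero {a} {r} {e} e≈0 a+re≈0 = begin
      a            ≈⟨ +-identityʳ a ⟨
      a + 0#       ≈⟨ +-congˡ (zeroʳ r) ⟨
      a + r * 0#   ≈⟨ +-congˡ (*-congˡ e≈0) ⟨
      a + r * e    ≈⟨ a+re≈0 ⟩
      0#           ∎

    -- Synthetic division read backwards: a Horner value is the coefficient plus r times the next
    -- Horner value. The first value is the remainder and the others form the quotient; if all
    -- vanish, so do the coefficients.
    quotient-zero : ∀ {m} (p : Vec Carrier (suc m)) r → eval p r ≈ 0# →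
                    All (_≈ 0#) (quotient p r) → All (_≈ 0#) p
    quotient-zero (a ∷ [])    r root []         = root-of-zero refl root ∷ []
    quotient-zero (a ∷ b ∷ p) r root (e≈0 ∷ q≈0) =
      root-of-zero e≈0 root ∷ quotient-zero (b ∷ p) r e≈0 q≈0

  -- Division by x - r leaves one coefficient fewer, and the quotient still vanishes at each
  -- remaining root s because s - r is nonzero.
  roots⇒zero : ∀ {m} (p rs : Vec Carrier m) → AllPairs _≉_ rs →
               All (λ r → eval p r ≈ 0#) rs → All (_≈ 0#) p
  roots⇒zero []        []       _                     _               = []
  roots⇒zero p@(_ ∷ _) (r ∷ rs) (r≉rs ∷ distinct) (root ∷ roots) =
    quotient-zero p r root (roots⇒zero (quotient p r) rs distinct (quotient-roots r≉rs roots))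
    where
    quotient-roots : ∀ {k} {ss : Vec Carrier k} → All (r ≉_) ss → All (λ s → eval p s ≈ 0#) ss →
                     All (λ s → eval (quotient p r) s ≈ 0#) ss
    quotient-roots []           []            = []
    quotient-roots {ss = s ∷ _} (r≉s ∷ r≉ss) (ps≈0 ∷ roots) =
      x≉0∧xy≈0⇒y≈0 (λ s-r≈0 → r≉s (sym (x∙y⁻¹≈ε⇒x≈y s r s-r≈0))) (begin
        (s - r) * eval (quotient p r) s              ≈⟨ +-identityʳ _ ⟨
        (s - r) * eval (quotient p r) s + 0#         ≈⟨ +-congˡ root ⟨
        (s - r) * eval (quotient p r) s + eval p r   ≈⟨ eval-quotient p r s ⟨
        eval p s                                     ≈⟨ ps≈0 ⟩
        0#                                           ∎)
      ∷ quotient-roots r≉ss roots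

  cubic-zero : 4 ≤ n → ∀ a₀ a₁ a₂ a₃ →
               (∀ t → t ≉ 0# → a₀ + t * (a₁ + t * (a₂ + t * a₃)) ≈ 0#) →
               a₀ ≈ 0# × a₁ ≈ 0# × a₂ ≈ 0# × a₃ ≈ 0#
  cubic-zero 4≤n a₀ a₁ a₂ a₃ vanishes =
    case roots⇒zero (a₀ ∷ a₁ ∷ a₂ ∷ a₃ ∷ []) (u 0F ∷ u 1F ∷ u 2F ∷ u 3F ∷ [])
      ((u-distinct (λ ()) ∷ u-distinct (λ ()) ∷ u-distinct (λ ()) ∷ []) ∷
       (u-distinct (λ ()) ∷ u-distinct (λ ()) ∷ []) ∷ (u-distinct (λ ()) ∷ []) ∷ [] ∷ [])
      (u-root 0F ∷ u-root 1F ∷ u-root 2F ∷ u-root 3F ∷ [])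
    of λ { (z₀ ∷ z₁ ∷ z₂ ∷ z₃ ∷ []) → z₀ , z₁ , z₂ , z₃ }
    where
    unit : Fin 4 → ∃[ x ] x ≉ 0#
    unit i = Inverse.from units-size (Fin.inject≤ i 4≤n)

    u : Fin 4 → Carrier
    u i = proj₁ (unit i)

    u-distinct : ∀ {i j} → i ≢ j → u i ≉ u j
    u-distinct i≢j ui≈uj = i≢j (Fin.inject≤-injective 4≤n 4≤n _ _
      (≡.trans (≡.sym (Inverse.inverseˡ units-size {y = unit _} refl))
               (Inverse.inverseˡ units-size {y = unit _} ui≈uj)))

    u-root : ∀ i → eval (a₀ ∷ a₁ ∷ a₂ ∷ a₃ ∷ []) (u i) ≈ 0#
    u-root i = trans
      (+-congˡ (*-congˡ (+-congˡ (*-congˡ (+-congˡ (*-congˡ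
        (trans (+-congˡ (zeroʳ _)) (+-identityʳ _))))))))
      (vanishes (u i) (proj₂ (unit i)))

-- The projective group and its action on points, point sets and lines.

module Projectivities {c ℓ : Level} {n : ℕ} (F : FiniteField c ℓ (suc n)) where

  open FiniteField F
  open ProjectiveSpace F
  open FieldProperties F
  open IntegerCoefficients commutativeRing
  open import Data.Vec.Functional using ([]; _∷_)
  open VectorEquality setoid using (_≋_; ≋-sym; ≋-trans)
  open import Algebra.Properties.CommutativeSemigroup *-commutativeSemigroup using (x∙yz≈y∙xz)
  open import Algebra.Properties.Semiring.Sum semiring
    using (sum-cong-≋; ∑-distrib-+; ∑-comm; *-distribˡ-sum; *-distribʳ-sum)
  open import Data.Integer.Base using (+_)
  open import Relation.Binary.Reasoning.Setoid setoid

  infixr 7 _*ᵛ_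
  infixr 6 _+ᵛ_

  _*ᵛ_ : Carrier → Coords → Coords
  (k *ᵛ x) i = k * x i

  _+ᵛ_ : Coords → Coords → Coords
  (x +ᵛ y) i = x i + y i

  ⋆-cong : ∀ {x y} {M N : Matrix} → x ≋ y → (∀ i → M i ≋ N i) → x ⋆ M ≋ y ⋆ N
  ⋆-cong {x} {y} {M} {N} x≋y M≋N j =
    sum-cong-≋ {x = λ i → x i * M i j} {y = λ i → y i * N i j} λ i → *-cong (x≋y i) (M≋N i j)

  ⋆-congˡ : ∀ {x y} (M : Matrix) → x ≋ y → x ⋆ M ≋ y ⋆ M
  ⋆-congˡ M x≋y = ⋆-cong {M = M} {M} x≋y λ _ _ → refl

  ⋆-*ᵛ : ∀ k x (M : Matrix) → (k *ᵛ x) ⋆ M ≋ k *ᵛ (x ⋆ M)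
  ⋆-*ᵛ k x M j = begin
    sum (λ i → k * x i * M i j)        ≈⟨ sum-cong-≋ (λ i → *-assoc k (x i) (M i j)) ⟩
    sum (λ i → k * (x i * M i j))      ≈⟨ *-distribˡ-sum k (λ i → x i * M i j) ⟨
    k * (x ⋆ M) j                      ∎

  ⋆-*ᴹ : ∀ k x (M : Matrix) → x ⋆ (λ i → k *ᵛ M i) ≋ k *ᵛ (x ⋆ M)
  ⋆-*ᴹ k x M j = begin
    sum (λ i → x i * (k * M i j))      ≈⟨ sum-cong-≋ (λ i → x∙yz≈y∙xz (x i) k (M i j)) ⟩
    sum (λ i → k * (x i * M i j))      ≈⟨ *-distribˡ-sum k (λ i → x i * M i j) ⟨
    k * (x ⋆ M) j                      ∎

  ⋆-+ᵛ : ∀ x y (M : Matrix) → (x +ᵛ y) ⋆ M ≋ (x ⋆ M) +ᵛ (y ⋆ M)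
  ⋆-+ᵛ x y M j = begin
    sum (λ i → (x i + y i) * M i j)               ≈⟨ sum-cong-≋ (λ i → distribʳ (M i j) (x i) (y i)) ⟩
    sum (λ i → x i * M i j + y i * M i j)         ≈⟨ ∑-distrib-+ (λ i → x i * M i j) (λ i → y i * M i j) ⟩
    (x ⋆ M) j + (y ⋆ M) j                         ∎

  ⋆-linear : ∀ a b x y (M : Matrix) → (a *ᵛ x +ᵛ b *ᵛ y) ⋆ M ≋ a *ᵛ (x ⋆ M) +ᵛ b *ᵛ (y ⋆ M)
  ⋆-linear a b x y M j =
    trans (⋆-+ᵛ (a *ᵛ x) (b *ᵛ y) M j) (+-cong (⋆-*ᵛ a x M j) (⋆-*ᵛ b y M j))

  ⋆-assoc : ∀ x (M N : Matrix) → x ⋆ M ⋆ N ≋ x ⋆ (λ i → M i ⋆ N)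
  ⋆-assoc x M N k = begin
    sum (λ j → sum (λ i → x i * M i j) * N j k)
      ≈⟨ sum-cong-≋ (λ j → *-distribʳ-sum (N j k) (λ i → x i * M i j)) ⟩
    sum (λ j → sum (λ i → x i * M i j * N j k))
      ≈⟨ ∑-comm (λ j i → x i * M i j * N j k) ⟩
    sum (λ i → sum (λ j → x i * M i j * N j k))
      ≈⟨ sum-cong-≋ (λ i → sum-cong-≋ (λ j → *-assoc (x i) (M i j) (N j k))) ⟩
    sum (λ i → sum (λ j → x i * (M i j * N j k)))
      ≈⟨ sum-cong-≋ (λ i → *-distribˡ-sum (x i) (λ j → M i j * N j k)) ⟨
    sum (λ i → x i * (M i ⋆ N) k) ∎

  𝟏 : Matrix
  𝟏 = (1# ∷ 0# ∷ 0# ∷ 0# ∷ []) ∷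
      (0# ∷ 1# ∷ 0# ∷ 0# ∷ []) ∷
      (0# ∷ 0# ∷ 1# ∷ 0# ∷ []) ∷
      (0# ∷ 0# ∷ 0# ∷ 1# ∷ []) ∷ []

  private
    O₄ I₄ : ∀ {m} → Polynomial m
    O₄ = con (+ 0)
    I₄ = con (+ 1)

  ⋆-identityʳ : ∀ x → x ⋆ 𝟏 ≋ x
  ⋆-identityʳ x 0F = solve 4 (λ x y z w → x :* I₄ :+ (y :* O₄ :+ (z :* O₄ :+ (w :* O₄ :+ O₄))) := x)
                       refl (x 0F) (x 1F) (x 2F) (x 3F)
  ⋆-identityʳ x 1F = solve 4 (λ x y z w → x :* O₄ :+ (y :* I₄ :+ (z :* O₄ :+ (w :* O₄ :+ O₄))) := y)
                       refl (x 0F) (x 1F) (x 2F) (x 3F)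
  ⋆-identityʳ x 2F = solve 4 (λ x y z w → x :* O₄ :+ (y :* O₄ :+ (z :* I₄ :+ (w :* O₄ :+ O₄))) := z)
                       refl (x 0F) (x 1F) (x 2F) (x 3F)
  ⋆-identityʳ x 3F = solve 4 (λ x y z w → x :* O₄ :+ (y :* O₄ :+ (z :* O₄ :+ (w :* I₄ :+ O₄))) := w)
                       refl (x 0F) (x 1F) (x 2F) (x 3F)

  𝟏-row : ∀ i (M : Matrix) → 𝟏 i ⋆ M ≋ M i
  𝟏-row 0F M j = solve 4 (λ x y z w → I₄ :* x :+ (O₄ :* y :+ (O₄ :* z :+ (O₄ :* w :+ O₄))) := x)
                   refl (M 0F j) (M 1F j) (M 2F j) (M 3F j)
  𝟏-row 1F M j = solve 4 (λ x y z w → O₄ :* x :+ (I₄ :* y :+ (O₄ :* z :+ (O₄ :* w :+ O₄))) := y)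
                   refl (M 0F j) (M 1F j) (M 2F j) (M 3F j)
  𝟏-row 2F M j = solve 4 (λ x y z w → O₄ :* x :+ (O₄ :* y :+ (I₄ :* z :+ (O₄ :* w :+ O₄))) := z)
                   refl (M 0F j) (M 1F j) (M 2F j) (M 3F j)
  𝟏-row 3F M j = solve 4 (λ x y z w → O₄ :* x :+ (O₄ :* y :+ (O₄ :* z :+ (I₄ :* w :+ O₄))) := w)
                   refl (M 0F j) (M 1F j) (M 2F j) (M 3F j)

  -- p ∼ r is, by unfolding, coords p ∝ coords r.
  infix 4 _∝_
  _∝_ : Coords → Coords → Set (c ⊔ ℓ)
  x ∝ y = ∃[ k ] k ≉ 0# × (x ≋ k *ᵛ y)

  ≋⇒∝ : ∀ {x y} → x ≋ y → x ∝ y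
  ≋⇒∝ x≋y = 1# , 1≉0 , λ i → trans (x≋y i) (sym (*-identityˡ _))

  -- The scalar cannot be zero, because the coordinates of a point are not all zero.
  multiple⇒∝ : ∀ p {x} k → coords p ≋ k *ᵛ x → coords p ∝ x
  multiple⇒∝ p k p≋kx =
    k , (λ k≈0 → nonzero p λ i → trans (p≋kx i) (trans (*-congʳ k≈0) (zeroˡ _))) , p≋kx

  ∝-refl : ∀ {x} → x ∝ x
  ∝-refl = ≋⇒∝ λ _ → refl

  ∝-sym : ∀ {x y} → x ∝ y → y ∝ x
  ∝-sym {x} {y} (k , k≉0 , x≋ky) = let k⁻¹ , kk⁻¹≈1 = inverse k k≉0 in
    k⁻¹ , inverse-≉0 kk⁻¹≈1 , λ i → begin
      y i                  ≈⟨ *-identityˡ _ ⟨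
      1# * y i             ≈⟨ *-congʳ kk⁻¹≈1 ⟨
      k * k⁻¹ * y i        ≈⟨ *-congʳ (*-comm k k⁻¹) ⟩
      k⁻¹ * k * y i        ≈⟨ *-assoc _ _ _ ⟩
      k⁻¹ * (k * y i)      ≈⟨ *-congˡ (x≋ky i) ⟨
      k⁻¹ * x i            ∎

  ∝-trans : ∀ {x y z} → x ∝ y → y ∝ z → x ∝ z
  ∝-trans (k , k≉0 , x≋ky) (m , m≉0 , y≋mz) =
    k * m , *-≉0 k≉0 m≉0 , λ i → trans (x≋ky i) (trans (*-congˡ (y≋mz i)) (sym (*-assoc k m _)))

  ∝-⋆ : ∀ {x y} (M : Matrix) → x ∝ y → x ⋆ M ∝ y ⋆ M
  ∝-⋆ {y = y} M (k , k≉0 , x≋ky) = k , k≉0 , ≋-trans (⋆-congˡ M x≋ky) (⋆-*ᵛ k y M)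

  infix 4 _≃_
  _≃_ : Projectivity → Projectivity → Set (c ⊔ ℓ)
  g ≃ h = matrix g ∼ᴹ matrix h

  infixl 7 _∙_
  infix  8 _⁻¹

  _∙_ : Projectivity → Projectivity → Projectivity
  g ∙ h = record
    { matrix   = λ i → matrix g i ⋆ matrix h
    ; matrix⁻¹ = λ i → matrix⁻¹ h i ⋆ matrix⁻¹ g
    ; leftInv  = λ x → cancel x (matrix g) (matrix h) (matrix⁻¹ h) (matrix⁻¹ g) (leftInv h) (leftInv g)
    ; rightInv = λ x → cancel x (matrix⁻¹ h) (matrix⁻¹ g) (matrix g) (matrix h) (rightInv g) (rightInv h)
    }
    where
    cancel : ∀ x (M N N′ M′ : Matrix) → (∀ x → x ⋆ N ⋆ N′ ≋ x) → (∀ x → x ⋆ M ⋆ M′ ≋ x) →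
             x ⋆ (λ i → M i ⋆ N) ⋆ (λ i → N′ i ⋆ M′) ≋ x
    cancel x M N N′ M′ NN′ MM′ =
      ≋-trans (⋆-congˡ (λ i → N′ i ⋆ M′) (≋-sym (⋆-assoc x M N))) $
      ≋-trans (≋-sym (⋆-assoc (x ⋆ M ⋆ N) N′ M′)) $
      ≋-trans (⋆-congˡ M′ (NN′ (x ⋆ M)))
              (MM′ x)

  _⁻¹ : Projectivity → Projectivity
  g ⁻¹ = record
    { matrix   = matrix⁻¹ g
    ; matrix⁻¹ = matrix g
    ; leftInv  = rightInv g
    ; rightInv = leftInv g
    }

  ε : Projectivity
  ε = record
    { matrix   = 𝟏
    ; matrix⁻¹ = 𝟏
    ; leftInv  = λ x → ≋-trans (⋆-congˡ 𝟏 (⋆-identityʳ x)) (⋆-identityʳ x)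
    ; rightInv = λ x → ≋-trans (⋆-congˡ 𝟏 (⋆-identityʳ x)) (⋆-identityʳ x)
    }

  matrices⇒≃ : ∀ {M N : Matrix} → (∀ i → M i ≋ N i) → M ∼ᴹ N
  matrices⇒≃ M≋N = 1# , 1≉0 , λ i j → trans (M≋N i j) (sym (*-identityˡ _))

  ∙-cong : ∀ {g g′ h h′} → g ≃ g′ → h ≃ h′ → g ∙ h ≃ g′ ∙ h′
  ∙-cong {g} {g′} {h} {h′} (k , k≉0 , g≈kg′) (m , m≉0 , h≈mh′) =
    k * m , *-≉0 k≉0 m≉0 , λ i j → begin
      (matrix g i ⋆ matrix h) j                                  ≈⟨ ⋆-cong (g≈kg′ i) h≈mh′ j ⟩
      ((k *ᵛ matrix g′ i) ⋆ (λ i → m *ᵛ matrix h′ i)) j          ≈⟨ ⋆-*ᵛ k (matrix g′ i) (λ i → m *ᵛ matrix h′ i) j ⟩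
      k * (matrix g′ i ⋆ (λ i → m *ᵛ matrix h′ i)) j             ≈⟨ *-congˡ (⋆-*ᴹ m (matrix g′ i) (matrix h′) j) ⟩
      k * (m * (matrix g′ i ⋆ matrix h′) j)                      ≈⟨ *-assoc k m _ ⟨
      k * m * (matrix g′ i ⋆ matrix h′) j                        ∎

  inverseʳ : ∀ g → g ∙ g ⁻¹ ≃ ε
  inverseʳ g = matrices⇒≃ λ i →
    ≋-trans (⋆-congˡ (matrix⁻¹ g) (≋-sym (𝟏-row i (matrix g)))) (leftInv g (𝟏 i))

  private
    ∙-assoc : ∀ g h k → (g ∙ h) ∙ k ≃ g ∙ (h ∙ k)
    ∙-assoc g h k = matrices⇒≃ λ i → ⋆-assoc (matrix g i) (matrix h) (matrix k)

    ε-identityˡ : ∀ g → ε ∙ g ≃ g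
    ε-identityˡ g = matrices⇒≃ λ i → 𝟏-row i (matrix g)

    ε-identityʳ : ∀ g → g ∙ ε ≃ g
    ε-identityʳ g = matrices⇒≃ λ i → ⋆-identityʳ (matrix g i)

    -- Inverse matrices are separate data, so they are compared through the group laws: g⁻¹ = g⁻¹ (h
    -- h⁻¹) = (g⁻¹ g) h⁻¹ = h⁻¹.
    ⁻¹-cong : ∀ {g h} → g ≃ h → g ⁻¹ ≃ h ⁻¹
    ⁻¹-cong {g} {h} g≃h =
      ∼ᴹ-trans (∼ᴹ-sym (ε-identityʳ (g ⁻¹))) $
      ∼ᴹ-trans (∙-cong {g ⁻¹} {g ⁻¹} {ε} {h ∙ h ⁻¹} (∼ᴹ-refl {matrix⁻¹ g}) (∼ᴹ-sym (inverseʳ h))) $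
      ∼ᴹ-trans (∼ᴹ-sym (∙-assoc (g ⁻¹) h (h ⁻¹))) $
      ∼ᴹ-trans (∙-cong {g ⁻¹ ∙ h} {g ⁻¹ ∙ g} {h ⁻¹} {h ⁻¹}
                  (∙-cong {g ⁻¹} {g ⁻¹} {h} {g} (∼ᴹ-refl {matrix⁻¹ g}) (∼ᴹ-sym g≃h)) (∼ᴹ-refl {matrix⁻¹ h})) $
      ∼ᴹ-trans (∙-cong {g ⁻¹ ∙ g} {ε} {h ⁻¹} {h ⁻¹} (inverseʳ (g ⁻¹)) (∼ᴹ-refl {matrix⁻¹ h}))
               (ε-identityˡ (h ⁻¹))

  -- Packaged as a group so that the general laws of division and conjugation hold modulo scalars.
  PGL : Group (c ⊔ ℓ) (c ⊔ ℓ)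
  PGL = record
    { Carrier = Projectivity
    ; _≈_     = _≃_
    ; _∙_     = _∙_
    ; ε       = ε
    ; _⁻¹     = _⁻¹
    ; isGroup = record
      { isMonoid = record
        { isSemigroup = record
          { isMagma = record
            { isEquivalence = record { refl = ∼ᴹ-refl ; sym = ∼ᴹ-sym ; trans = ∼ᴹ-trans }
            ; ∙-cong        = λ {g} {g′} {h} {h′} → ∙-cong {g} {g′} {h} {h′}
            }
          ; assoc = ∙-assoc
          }
        ; identity = ε-identityˡ , ε-identityʳ
        }
      ; inverse = (λ g → inverseʳ (g ⁻¹)) , inverseʳ
      ; ⁻¹-cong = λ {g} {h} → ⁻¹-cong {g} {h}
      }
    }

  apply-∙ : ∀ g h p → apply (g ∙ h) p ∼ apply h (apply g p)
  apply-∙ g h p = ≋⇒∝ (≋-sym (⋆-assoc (coords p) (matrix g) (matrix h)))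

  apply-⁻¹ : ∀ g p → apply (g ⁻¹) (apply g p) ∼ p
  apply-⁻¹ g p = ≋⇒∝ (leftInv g (coords p))

  apply-transpose : ∀ g p r → p ∼ apply g r → apply (g ⁻¹) p ∼ r
  apply-transpose g p r p∼gr = ∝-trans (∝-⋆ (matrix⁻¹ g) p∼gr) (apply-⁻¹ g r)

  apply-injective : ∀ g p r → apply g p ∼ apply g r → p ∼ r
  apply-injective g p r gp∼gr = ∝-trans (∝-sym (apply-⁻¹ g p)) (apply-transpose g (apply g p) r gp∼gr)

  apply-resp : ∀ {g h} → g ≃ h → ∀ p → apply g p ∼ apply h p
  apply-resp {g} {h} (k , k≉0 , g≈kh) p =
    k , k≉0 , ≋-trans (⋆-cong {coords p} {M = matrix g} {λ i → k *ᵛ matrix h i} (λ _ → refl) g≈kh)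
                      (⋆-*ᴹ k (coords p) (matrix h))

  image-resp : ∀ {g h} (S : Pred Point (c ⊔ ℓ)) → g ≃ h → image g S ≐ image h S
  image-resp {g} {h} S g≃h =
    (λ (p , p∈S , r∼gp) → p , p∈S , ∝-trans r∼gp (apply-resp {g} {h} g≃h p)) ,
    (λ (p , p∈S , r∼hp) → p , p∈S , ∝-trans r∼hp (∝-sym (apply-resp {g} {h} g≃h p)))

  image-cong : ∀ {S T : Pred Point (c ⊔ ℓ)} g → S ≐ T → image g S ≐ image g T
  image-cong g (S⊆T , T⊆S) =
    (λ (p , p∈S , r∼gp) → p , S⊆T {p} p∈S , r∼gp) ,
    (λ (p , p∈T , r∼gp) → p , T⊆S {p} p∈T , r∼gp)

  image-∙ : ∀ {S T U : Pred Point (c ⊔ ℓ)} g h → image g S ≐ T → image h T ≐ U → image (g ∙ h) S ≐ U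
  image-∙ g h (gS⊆T , T⊆gS) (hT⊆U , U⊆hT) =
    (λ {r} (p , p∈S , r∼ghp) →
      hT⊆U {r} (apply g p , gS⊆T {apply g p} (p , p∈S , ∝-refl) , ∝-trans r∼ghp (apply-∙ g h p))) ,
    λ {r} r∈U → let t , t∈T , r∼ht = U⊆hT {r} r∈U
                    p , p∈S , t∼gp = T⊆gS {t} t∈T
      in p , p∈S , ∝-trans r∼ht (∝-trans (∝-⋆ (matrix h) t∼gp) (∝-sym (apply-∙ g h p)))

  -- Strips from a product a left factor whose effect on the set is known; applied later to a
  -- diagonal factor fixing `ℓ₀`.
  image-∙-cancel : ∀ {S T U : Pred Point (c ⊔ ℓ)} g h →
                   image g S ≐ T → image (g ∙ h) S ≐ U → image h T ≐ U
  image-∙-cancel g h (gS⊆T , T⊆gS) (ghS⊆U , U⊆ghS) =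
    (λ {r} (t , t∈T , r∼ht) → let p , p∈S , t∼gp = T⊆gS {t} t∈T in
      ghS⊆U {r} (p , p∈S , ∝-trans r∼ht (∝-trans (∝-⋆ (matrix h) t∼gp) (∝-sym (apply-∙ g h p))))) ,
    λ {r} r∈U → let p , p∈S , r∼ghp = U⊆ghS {r} r∈U in
      apply g p , gS⊆T {apply g p} (p , p∈S , ∝-refl) , ∝-trans r∼ghp (apply-∙ g h p)

  -- Pulling back recovers a point of `S` only up to a scalar, hence the closure condition on `S`.
  image-⁻¹ : ∀ {S T : Pred Point (c ⊔ ℓ)} g → S Respects _∼_ → image g S ≐ T → image (g ⁻¹) T ≐ S
  image-⁻¹ g S-resp (gS⊆T , T⊆gS) =
    (λ {r} (t , t∈T , r∼g⁻¹t) → let p , p∈S , t∼gp = T⊆gS {t} t∈T in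
      S-resp {p} {r} (∝-sym (∝-trans r∼g⁻¹t (apply-transpose g t p t∼gp))) p∈S) ,
    λ {r} r∈S → apply g r , gS⊆T {apply g r} (r , r∈S , ∝-refl) , ∝-sym (apply-⁻¹ g r)

  join-resp : ∀ p r → join p r Respects _∼_
  join-resp p r s∼t (a , b , s≋ap+br) = let k , _ , t≋ks = ∝-sym s∼t in
    k * a , k * b , λ i → trans (t≋ks i) (trans (*-congˡ (s≋ap+br i))
      (solve 5 (λ k a x b y → k :* (a :* x :+ b :* y) := k :* a :* x :+ k :* b :* y)
        refl k a (coords p i) b (coords r i)))

  p∈join : ∀ p r → p ∈ join p r
  p∈join p r = 1# , 0# , λ i →
    solve 2 (λ x y → x := con (+ 1) :* x :+ con (+ 0) :* y) refl (coords p i) (coords r i)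

  r∈join : ∀ p r → r ∈ join p r
  r∈join p r = 0# , 1# , λ i →
    solve 2 (λ x y → y := con (+ 0) :* x :+ con (+ 1) :* y) refl (coords p i) (coords r i)

  private
    join-⊆ : ∀ p r s t → p ∈ join s t → r ∈ join s t → join p r ⊆ join s t
    join-⊆ p r s t (a , b , p≋) (a′ , b′ , r≋) (k , m , x≋) =
      k * a + m * a′ , k * b + m * b′ , λ i → trans (x≋ i)
        (trans (+-cong (*-congˡ (p≋ i)) (*-congˡ (r≋ i)))
          (solve 8 (λ k a b m a′ b′ s t →
              k :* (a :* s :+ b :* t) :+ m :* (a′ :* s :+ b′ :* t) :=
              (k :* a :+ m :* a′) :* s :+ (k :* b :+ m :* b′) :* t)
            refl k a b m a′ b′ (coords s i) (coords t i)))

  join-≐ : ∀ p r s t → p ∈ join s t → r ∈ join s t → s ∈ join p r → t ∈ join p r → join p r ≐ join s t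
  join-≐ p r s t p∈st r∈st s∈pr t∈pr =
    (λ {x} → join-⊆ p r s t p∈st r∈st {x}) , (λ {x} → join-⊆ s t p r s∈pr t∈pr {x})

  image-join : ∀ g p r → image g (join p r) ≐ join (apply g p) (apply g r)
  image-join g p r =
    (λ {t} (s , (a , b , s≋) , t∼gs) → join-resp (apply g p) (apply g r) {apply g s} {t} (∝-sym t∼gs)
      (a , b , ≋-trans (⋆-congˡ (matrix g) s≋) (⋆-linear a b (coords p) (coords r) (matrix g)))) ,
    λ {t} (a , b , t≋) →
      apply (g ⁻¹) t ,
      (a , b , ≋-trans (⋆-congˡ (matrix⁻¹ g) t≋)
        (≋-trans (⋆-linear a b (coords p ⋆ matrix g) (coords r ⋆ matrix g) (matrix⁻¹ g))
          λ i → +-cong (*-congˡ (leftInv g (coords p) i)) (*-congˡ (leftInv g (coords r) i)))) ,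
      ∝-sym (apply-⁻¹ (g ⁻¹) t)

  join-swap : ∀ p r → join p r ≐ join r p
  join-swap p r = join-≐ p r r p (r∈join r p) (p∈join r p) (r∈join p r) (p∈join p r)

  join-cong : ∀ p r s t → p ∼ s → r ∼ t → join p r ≐ join s t
  join-cong p r s t p∼s r∼t = join-≐ p r s t
    (join-resp s t {s} {p} (∝-sym p∼s) (p∈join s t))
    (join-resp s t {t} {r} (∝-sym r∼t) (r∈join s t))
    (join-resp p r {p} {s} p∼s (p∈join p r))
    (join-resp p r {r} {t} r∼t (r∈join p r))

  join-exchange : ∀ p r s a b → b ≉ 0# → coords s ≋ a *ᵛ coords p +ᵛ b *ᵛ coords r → join p s ≐ join p r
  join-exchange p r s a b b≉0 s≋ap+br = let b⁻¹ , bb⁻¹≈1 = inverse b b≉0 in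
    join-≐ p s p r (p∈join p r) (a , b , s≋ap+br) (p∈join p s)
      -- The coefficients of r = b⁻¹ (s - a p).
      (- (b⁻¹ * a) , b⁻¹ , λ i → begin
        coords r i                     ≈⟨ *-identityˡ _ ⟨
        1# * coords r i                ≈⟨ *-congʳ bb⁻¹≈1 ⟨
        b * b⁻¹ * coords r i           ≈⟨ solve 5 (λ a b b⁻¹ p r → b :* b⁻¹ :* r :=
                                            (:- (b⁻¹ :* a)) :* p :+ b⁻¹ :* (a :* p :+ b :* r))
                                            refl a b b⁻¹ (coords p i) (coords r i) ⟩
        - (b⁻¹ * a) * coords p i + b⁻¹ * (a * coords p i + b * coords r i)
                                       ≈⟨ +-congˡ (*-congˡ (s≋ap+br i)) ⟨
        - (b⁻¹ * a) * coords p i + b⁻¹ * coords s i ∎)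

  -- If p has a nonzero coefficient at the first spanning point, it can replace that point and the
  -- second remains as r. Otherwise p is the second point up to a scalar, and the first remains.
  line-through : ∀ l p → p ∈ ⟦ l ⟧ → ∃[ r ] ⟦ l ⟧ ≐ join p r
  line-through (line a b _) p (α , β , p≋) with α ≈? 0#
  ... | no α≉0 =
    b , ≐-trans (join-swap a b)
          (≐-trans (≐-sym (join-exchange b a p β α α≉0 λ i → trans (p≋ i) (+-comm _ _))) (join-swap b p))
  ... | yes α≈0 = a , ≐-trans (join-swap a b) (join-cong b a p a (∝-sym p∼b) ∝-refl)
    where
    p∼b : p ∼ b
    p∼b = multiple⇒∝ p β λ i →
      trans (p≋ i) (trans (+-congʳ (trans (*-congʳ α≈0) (zeroˡ _))) (+-identityˡ _))

  -- The join of two proportional vectors holds a single point, so the two spanning points of l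
  -- would coincide.
  line-not-degenerate : ∀ l p r → ⟦ l ⟧ ≐ join p r → ¬ (r ∼ p)
  line-not-degenerate (line a b a≁b) p r (l⊆pr , _) (k , _ , r≋kp) =
    a≁b (∝-trans (on-p a (l⊆pr {a} (p∈join a b))) (∝-sym (on-p b (l⊆pr {b} (r∈join a b)))))
    where
    on-p : ∀ s → s ∈ join p r → s ∼ p
    on-p s (x , y , s≋) = multiple⇒∝ s (x + y * k) λ i →
      trans (s≋ i) (trans (+-congˡ (*-congˡ (r≋kp i)))
        (solve 4 (λ x y k p → x :* p :+ y :* (k :* p) := (x :+ y :* k) :* p) refl x y k (coords p i)))

-- Explicit projectivities preserving the twisted cubic.

-- Over an arbitrary raw ring, so that the same matrices exist over the ring
-- solver's polynomials.
module SymbolicMatrices {c ℓ} (R : RawRing c ℓ) where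

  open RawRing R
  open import Data.Vec.Functional using (Vector; []; _∷_)
  open import Algebra.Definitions.RawSemiring rawSemiring using (_^_; sum) renaming (_×_ to _·_)

  infixl 7 _⊙_

  _⊙_ : Vector Carrier 4 → Vector (Vector Carrier 4) 4 → Vector Carrier 4
  (x ⊙ M) j = sum (λ i → x i * M i j)

  -- The standard matrix for a = d = 1, b = t, c = 0, acting as u ↦ u + t on parameters. Its last
  -- row is P_t and its third row is the tangent direction there; later lemmas read both off as
  -- rows.
  translation : Carrier → Vector (Vector Carrier 4) 4
  translation t =
    (1#        ∷ 0#    ∷ 0# ∷ 0# ∷ []) ∷
    (3 · t     ∷ 1#    ∷ 0# ∷ 0# ∷ []) ∷
    (3 · t ^ 2 ∷ 2 · t ∷ 1# ∷ 0# ∷ []) ∷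
    (t ^ 3     ∷ t ^ 2 ∷ t  ∷ 1# ∷ []) ∷ []

  -- The standard matrix for a = d = 0, b = c = 1, acting as t ↦ 1 / t on parameters and exchanging
  -- P₀ and P_∞.
  reversal : Vector (Vector Carrier 4) 4
  reversal =
    (0# ∷ 0# ∷ 0# ∷ 1# ∷ []) ∷
    (0# ∷ 0# ∷ 1# ∷ 0# ∷ []) ∷
    (0# ∷ 1# ∷ 0# ∷ 0# ∷ []) ∷
    (1# ∷ 0# ∷ 0# ∷ 0# ∷ []) ∷ []

  diagonalMatrix : Carrier → Vector (Vector Carrier 4) 4
  diagonalMatrix d =
    (1# ∷ 0# ∷ 0#    ∷ 0#    ∷ []) ∷
    (0# ∷ d  ∷ 0#    ∷ 0#    ∷ []) ∷
    (0# ∷ 0# ∷ d ^ 2 ∷ 0#    ∷ []) ∷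
    (0# ∷ 0# ∷ 0#    ∷ d ^ 3 ∷ []) ∷ []

module CubicGroup {c ℓ : Level} {n : ℕ} (F : FiniteField c ℓ (suc n)) where

  open FiniteField F
  open TwistedCubic F
  open FieldProperties F
  open Projectivities F
  open IntegerCoefficients commutativeRing
  open import Data.Vec.Functional using ([]; _∷_)
  open VectorEquality setoid using (_≋_; ≋-sym; ≋-trans)
  open import Data.Integer.Base using (+_)
  open SymbolicMatrices rawRing using (translation; reversal)

  private
    polynomials : ℕ → RawRing _ _
    polynomials m = record
      { Carrier = Polynomial m
      ; _≈_     = _≡_
      ; _+_     = _:+_
      ; _*_     = _:*_
      ; -_      = :-_
      ; 0#      = con (+ 0)
      ; 1#      = con (+ 1)
      }

    module S {m} = SymbolicMatrices (polynomials m)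
    open S using (_⊙_)

  ⋆-translation-+ : ∀ a b x → x ⋆ translation a ⋆ translation b ≋ x ⋆ translation (a + b)
  ⋆-translation-+ a b x = λ where
      0F → solve 6 (eq 0F) refl a b (x 0F) (x 1F) (x 2F) (x 3F)
      1F → solve 6 (eq 1F) refl a b (x 0F) (x 1F) (x 2F) (x 3F)
      2F → solve 6 (eq 2F) refl a b (x 0F) (x 1F) (x 2F) (x 3F)
      3F → solve 6 (eq 3F) refl a b (x 0F) (x 1F) (x 2F) (x 3F)
    where
    eq : Fin 4 → (a b x y z w : Polynomial 6) → Polynomial 6 × Polynomial 6
    eq i a b x y z w = let v = x ∷ y ∷ z ∷ w ∷ [] in
      (v ⊙ S.translation a ⊙ S.translation b) i := (v ⊙ S.translation (a :+ b)) i

  ⋆-translation-0 : ∀ {t} → t ≈ 0# → ∀ x → x ⋆ translation t ≋ x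
  ⋆-translation-0 {t} t≈0 x = λ where
      0F → vanish (solve 5 (eq 0F (λ t y z w → :3 :* y :+ (:3 :* t :* z :+ t :* t :* w))) refl
                     t (x 0F) (x 1F) (x 2F) (x 3F))
      1F → vanish (solve 5 (eq 1F (λ t y z w → :2 :* z :+ t :* w)) refl
                     t (x 0F) (x 1F) (x 2F) (x 3F))
      2F → vanish (solve 5 (eq 2F (λ t y z w → w)) refl t (x 0F) (x 1F) (x 2F) (x 3F))
      3F → solve 5 (λ t x y z w → ((x ∷ y ∷ z ∷ w ∷ []) ⊙ S.translation t) 3F := w) refl
             t (x 0F) (x 1F) (x 2F) (x 3F)
    where
    :2 :3 : Polynomial 5
    :2 = con (+ 2)
    :3 = con (+ 3)

    eq : Fin 4 → (r : (t y z w : Polynomial 5) → Polynomial 5) →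
         (t x y z w : Polynomial 5) → Polynomial 5 × Polynomial 5
    eq i r t x y z w = let v = x ∷ y ∷ z ∷ w ∷ [] in
      (v ⊙ S.translation t) i := v i :+ t :* r t y z w

    vanish : ∀ {u v w} → u ≈ v + t * w → u ≈ v
    vanish u≈ = trans u≈ (trans (+-congˡ (trans (*-congʳ t≈0) (zeroˡ _))) (+-identityʳ _))

  T : Carrier → Projectivity
  T t = record
    { matrix   = translation t
    ; matrix⁻¹ = translation (- t)
    ; leftInv  = λ x → ≋-trans (⋆-translation-+ t (- t) x) (⋆-translation-0 (-‿inverseʳ t) x)
    ; rightInv = λ x → ≋-trans (⋆-translation-+ (- t) t x) (⋆-translation-0 (-‿inverseˡ t) x)
    }

  reverse : Coords → Coords
  reverse x = x 3F ∷ x 2F ∷ x 1F ∷ x 0F ∷ []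

  ⋆-reversal : ∀ x → x ⋆ reversal ≋ reverse x
  ⋆-reversal x = λ where
      0F → solve 4 (eq 0F) refl (x 0F) (x 1F) (x 2F) (x 3F)
      1F → solve 4 (eq 1F) refl (x 0F) (x 1F) (x 2F) (x 3F)
      2F → solve 4 (eq 2F) refl (x 0F) (x 1F) (x 2F) (x 3F)
      3F → solve 4 (eq 3F) refl (x 0F) (x 1F) (x 2F) (x 3F)
    where
    eq : Fin 4 → (x y z w : Polynomial 4) → Polynomial 4 × Polynomial 4
    eq i x y z w = ((x ∷ y ∷ z ∷ w ∷ []) ⊙ S.reversal) i := (w ∷ z ∷ y ∷ x ∷ []) i

  J : Projectivity
  J = record { matrix = reversal ; matrix⁻¹ = reversal ; leftInv = involutive ; rightInv = involutive }
    where
    involutive : ∀ x → x ⋆ reversal ⋆ reversal ≋ x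
    involutive x = λ where
      0F → trans (⋆-reversal (x ⋆ reversal) 0F) (⋆-reversal x 3F)
      1F → trans (⋆-reversal (x ⋆ reversal) 1F) (⋆-reversal x 2F)
      2F → trans (⋆-reversal (x ⋆ reversal) 2F) (⋆-reversal x 1F)
      3F → trans (⋆-reversal (x ⋆ reversal) 3F) (⋆-reversal x 0F)

  ⋆-diagonal : ∀ d x → x ⋆ diagonal d ≋ (x 0F ∷ d * x 1F ∷ d ^ 2 * x 2F ∷ d ^ 3 * x 3F ∷ [])
  ⋆-diagonal d x = λ where
      0F → solve 5 (eq 0F) refl d (x 0F) (x 1F) (x 2F) (x 3F)
      1F → solve 5 (eq 1F) refl d (x 0F) (x 1F) (x 2F) (x 3F)
      2F → solve 5 (eq 2F) refl d (x 0F) (x 1F) (x 2F) (x 3F)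
      3F → solve 5 (eq 3F) refl d (x 0F) (x 1F) (x 2F) (x 3F)
    where
    eq : Fin 4 → (d x y z w : Polynomial 5) → Polynomial 5 × Polynomial 5
    eq i d x y z w = ((x ∷ y ∷ z ∷ w ∷ []) ⊙ S.diagonalMatrix d) i :=
                     (x ∷ d :* y ∷ d :^ 2 :* z ∷ d :^ 3 :* w ∷ []) i

  drop-unit : ∀ {u} → u ≈ 1# → ∀ x → u * x ≈ x
  drop-unit u≈1 x = trans (*-congʳ u≈1) (*-identityˡ x)

  drop-unit² : ∀ {u} → u ≈ 1# → ∀ x → u * (u * x) ≈ x
  drop-unit² u≈1 x = trans (drop-unit u≈1 _) (drop-unit u≈1 x)

  drop-unit³ : ∀ {u} → u ≈ 1# → ∀ x → u * (u * (u * x)) ≈ x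
  drop-unit³ u≈1 x = trans (drop-unit² u≈1 _) (drop-unit u≈1 x)

  D : ∀ d → d ≉ 0# → Projectivity
  D d d≉0 = let e , de≈1 = inverse d d≉0 in record
    { matrix   = diagonal d
    ; matrix⁻¹ = diagonal e
    ; leftInv  = cancel d e de≈1
    ; rightInv = cancel e d (trans (*-comm e d) de≈1)
    }
    where
    cancel : ∀ d e → d * e ≈ 1# → ∀ x → x ⋆ diagonal d ⋆ diagonal e ≋ x
    cancel d e de≈1 x i = trans (⋆-diagonal e (x ⋆ diagonal d) i) (go i)
      where
      go : ∀ i → (let y = x ⋆ diagonal d in (y 0F ∷ e * y 1F ∷ e ^ 2 * y 2F ∷ e ^ 3 * y 3F ∷ []) i) ≈ x i
      go 0F = ⋆-diagonal d x 0F
      go 1F = trans (*-congˡ (⋆-diagonal d x 1F))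
        (trans (solve 3 (λ d e x → e :* (d :* x) := d :* e :* x) refl d e (x 1F))
               (drop-unit de≈1 (x 1F)))
      go 2F = trans (*-congˡ (⋆-diagonal d x 2F))
        (trans (solve 3 (λ d e x → (e :^ 2) :* ((d :^ 2) :* x) := d :* e :* (d :* e :* x)) refl d e (x 2F))
               (drop-unit² de≈1 (x 2F)))
      go 3F = trans (*-congˡ (⋆-diagonal d x 3F))
        (trans (solve 3 (λ d e x → (e :^ 3) :* ((d :^ 3) :* x) :=
                                   d :* e :* (d :* e :* (d :* e :* x))) refl d e (x 3F))
               (drop-unit³ de≈1 (x 3F)))

  O E E₂ : Point
  O  = Line.p₁ ℓ₀
  E  = Line.p₂ ℓ₀
  E₂ = P (𝟏 2F) λ h → 1≉0 (h 2F)

  Preserves𝒞 : Matrix → Set (c ⊔ ℓ)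
  Preserves𝒞 M = ∀ t → ∃[ u ] coords (cubicPoint t) ⋆ M ∝ coords (cubicPoint u)

  preserves⇒G : ∀ g → Preserves𝒞 (matrix g) → Preserves𝒞 (matrix⁻¹ g) → image g 𝒞 ≐ 𝒞
  preserves⇒G g pres pres⁻¹ =
    (λ (p , (t , p∼Pt) , r∼gp) → let u , Ptg∼Pu = pres t in
      u , ∝-trans r∼gp (∝-trans (∝-⋆ (matrix g) p∼Pt) Ptg∼Pu)) ,
    λ {r} (t , r∼Pt) → let u , Ptg⁻¹∼Pu = pres⁻¹ t in
      apply (g ⁻¹) r , (u , ∝-trans (∝-⋆ (matrix⁻¹ g) r∼Pt) Ptg⁻¹∼Pu) , ∝-sym (apply-⁻¹ (g ⁻¹) r)

  𝒞-resp : 𝒞 Respects _∼_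
  𝒞-resp p∼r (t , p∼Pt) = t , ∝-trans (∝-sym p∼r) p∼Pt

  ^3-≉0 : ∀ {t} → t ≉ 0# → t ^ 3 ≉ 0#
  ^3-≉0 t≉0 = *-≉0 t≉0 (*-≉0 t≉0 (*-≉0 t≉0 1≉0))

  cubicPoint-cong : ∀ {t u} → t ≈ u → coords (cubicPoint (fin t)) ≋ coords (cubicPoint (fin u))
  cubicPoint-cong t≈u = λ where
    0F → *-cong t≈u (*-cong t≈u (*-congʳ t≈u))
    1F → *-cong t≈u (*-congʳ t≈u)
    2F → t≈u
    3F → refl

  P₀≋O : ∀ {t} → t ≈ 0# → coords (cubicPoint (fin t)) ≋ coords O
  P₀≋O t≈0 = λ where
    0F → trans (*-congʳ t≈0) (zeroˡ _)
    1F → trans (*-congʳ t≈0) (zeroˡ _)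
    2F → t≈0
    3F → refl

  -- P_u is the last row of `translation u`, so this is the last row of the additivity of
  -- translations.
  translation-shifts : ∀ t u →
                       coords (cubicPoint (fin u)) ⋆ translation t ≋ coords (cubicPoint (fin (u + t)))
  translation-shifts t u =
    ≋-trans (⋆-congˡ (translation t) (≋-sym (𝟏-row 3F (translation u)))) $
    ≋-trans (⋆-translation-+ u t (𝟏 3F)) (𝟏-row 3F (translation (u + t)))

  translation-preserves : ∀ t → Preserves𝒞 (translation t)
  translation-preserves t (fin u) = fin (u + t) , ≋⇒∝ (translation-shifts t u)
  translation-preserves t ∞       = ∞ , ≋⇒∝ (𝟏-row 0F (translation t))

  -- For s = 1 / t, the vector (1, t, t², t³) is t³ times (s³, s², s, 1).
  reverse-cubicPoint : ∀ {t s} → t * s ≈ 1# →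
                       reverse (coords (cubicPoint (fin t))) ∝ coords (cubicPoint (fin s))
  reverse-cubicPoint {t} {s} ts≈1 = t ^ 3 , ^3-≉0 (inverse-≉0 (trans (*-comm s t) ts≈1)) , λ where
    0F → sym (trans (solve 2 (λ t s → t :^ 3 :* s :^ 3 := 
                                           t :* s :* (t :* s :* (t :* s :* con (+ 1)))) refl t s)
                    (drop-unit³ ts≈1 1#))
    1F → sym (trans (solve 2 (λ t s → t :^ 3 :* s :^ 2 := t :* s :* (t :* s :* t)) refl t s)
                    (drop-unit² ts≈1 t))
    2F → sym (trans (solve 2 (λ t s → t :^ 3 :* s := t :* s :* t :^ 2) refl t s) (drop-unit ts≈1 (t ^ 2)))
    3F → sym (*-identityʳ _)

  reversal-preserves : Preserves𝒞 reversal
  reversal-preserves ∞ = fin 0# , ≋⇒∝ (≋-trans (𝟏-row 0F reversal) (≋-sym (P₀≋O refl)))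
  reversal-preserves (fin t) with t ≈? 0#
  ... | yes t≈0 = ∞ , ≋⇒∝ (≋-trans (⋆-congˡ reversal (P₀≋O t≈0)) (𝟏-row 3F reversal))
  ... | no  t≉0 = let s , ts≈1 = inverse t t≉0 in
    fin s , ∝-trans (≋⇒∝ (⋆-reversal (coords (cubicPoint (fin t))))) (reverse-cubicPoint ts≈1)

  -- On parameters this is t ↦ t / d, with scalar d³.
  diagonal-preserves : ∀ d → d ≉ 0# → Preserves𝒞 (diagonal d)
  diagonal-preserves d d≉0 ∞ = ∞ , ≋⇒∝ (≋-trans (⋆-diagonal d (𝟏 0F)) λ where
    0F → refl
    1F → zeroʳ _
    2F → zeroʳ _
    3F → zeroʳ _)
  diagonal-preserves d d≉0 (fin t) = let e , de≈1 = inverse d d≉0 in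
    fin (t * e) , ∝-trans (≋⇒∝ (⋆-diagonal d (coords (cubicPoint (fin t))))) (d ^ 3 , ^3-≉0 d≉0 , λ where
      0F → sym (trans (solve 3 (λ d e t → d :^ 3 :* (t :* e) :^ 3 :=
                                             d :* e :* (d :* e :* (d :* e :* t :^ 3))) refl d e t)
                      (drop-unit³ de≈1 _))
      1F → sym (trans (solve 3 (λ d e t → d :^ 3 :* (t :* e) :^ 2 :=
                                             d :* e :* (d :* e :* (d :* t :^ 2))) refl d e t)
                      (drop-unit² de≈1 _))
      2F → sym (trans (solve 3 (λ d e t → d :^ 3 :* (t :* e) := d :* e :* (d :^ 2 :* t)) refl d e t)
                      (drop-unit de≈1 _))
      3F → refl)

  T∈G : ∀ t → image (T t) 𝒞 ≐ 𝒞
  T∈G t = preserves⇒G (T t) (translation-preserves t) (translation-preserves (- t))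

  J∈G : image J 𝒞 ≐ 𝒞
  J∈G = preserves⇒G J reversal-preserves reversal-preserves

  D∈G : ∀ d d≉0 → image (D d d≉0) 𝒞 ≐ 𝒞
  D∈G d d≉0 = let e , de≈1 = inverse d d≉0 in
    preserves⇒G (D d d≉0) (diagonal-preserves d d≉0) (diagonal-preserves e (inverse-≉0 de≈1))

  -- t ↦ t / (c t + 1), the conjugate of a translation by t ↦ 1 / t.
  U : Carrier → Projectivity
  U c = J ∙ T c ∙ J

  U∈G : ∀ c → image (U c) 𝒞 ≐ 𝒞
  U∈G c = image-∙ (J ∙ T c) J (image-∙ J (T c) J∈G (T∈G c)) J∈G

  ⋆-U : ∀ c x → x ⋆ matrix (U c) ≋ reverse (reverse x ⋆ translation c)
  ⋆-U c x =
    ≋-trans (≋-sym (⋆-assoc x (matrix (J ∙ T c)) reversal)) $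
    ≋-trans (⋆-congˡ reversal (≋-trans (≋-sym (⋆-assoc x reversal (translation c)))
                                       (⋆-congˡ (translation c) (⋆-reversal x)))) $
    ⋆-reversal (reverse x ⋆ translation c)

  reverse-cong : ∀ {x y} → x ≋ y → reverse x ≋ reverse y
  reverse-cong x≋y = λ where
    0F → x≋y 3F
    1F → x≋y 2F
    2F → x≋y 1F
    3F → x≋y 0F

  ⋆-U-0 : ∀ {c} → c ≈ 0# → ∀ x → x ⋆ matrix (U c) ≋ x
  ⋆-U-0 {c} c≈0 x = ≋-trans (⋆-U c x) (≋-trans (reverse-cong (⋆-translation-0 c≈0 (reverse x)))
    λ { 0F → refl ; 1F → refl ; 2F → refl ; 3F → refl })

  O⋆U : ∀ c → coords O ⋆ matrix (U c) ≋ coords O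
  O⋆U c = ≋-trans (⋆-U c (coords O)) (reverse-cong (𝟏-row 0F (translation c)))

  -- Reversal turns `E` into the third coordinate vector, so the result is the tangent direction at
  -- P_c, reversed.
  E⋆U : ∀ c → coords E ⋆ matrix (U c) ≋ (0# ∷ 1# ∷ 2 · c ∷ 3 · c ^ 2 ∷ [])
  E⋆U c = ≋-trans (⋆-U c (coords E)) (reverse-cong (𝟏-row 2F (translation c)))

  ∞⋆U : ∀ c → coords (cubicPoint ∞) ⋆ matrix (U c) ≋ reverse (coords (cubicPoint (fin c)))
  ∞⋆U c = ≋-trans (⋆-U c (𝟏 0F)) (reverse-cong (𝟏-row 3F (translation c)))

  -- Carries P₀ to P_t, and with it the tangent and the osculating plane at P₀ to those at P_t.
  B : Parameter → Projectivity
  B (fin t) = T t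
  B ∞       = J

  B∈G : ∀ t → image (B t) 𝒞 ≐ 𝒞
  B∈G (fin t) = T∈G t
  B∈G ∞       = J∈G

  O⋆B : ∀ t → coords O ⋆ matrix (B t) ≋ coords (cubicPoint t)
  O⋆B (fin t) = 𝟏-row 3F (translation t)
  O⋆B ∞       = 𝟏-row 3F reversal

  B-tangent : ∀ t → image (B t) (join O E₂) ≐ tangent t
  B-tangent (fin t) = ≐-trans (image-join (T t) O E₂) $
    join-cong (apply (T t) O) (apply (T t) E₂) (cubicPoint (fin t)) (tangentDirection t)
      (≋⇒∝ (O⋆B (fin t))) (≋⇒∝ (𝟏-row 2F (translation t)))
  B-tangent ∞ = ≐-trans (image-join J O E₂) $
    (λ (a , b , s≋) → lift (vanish s≋ 2F refl refl , vanish s≋ 3F refl refl)) ,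
    -- `J` sends `O` and `E₂` to the first two coordinate vectors, so the coordinates of s serve as
    -- coefficients.
    λ {s} (lift (s₂≈0 , s₃≈0)) → coords s 0F , coords s 1F , λ where
      0F → trans (solve 2 (λ a b → a := a :* con (+ 1) :+ b :* con (+ 0)) refl _ _) (sym (at s 0F))
      1F → trans (solve 2 (λ a b → b := a :* con (+ 0) :+ b :* con (+ 1)) refl _ _) (sym (at s 1F))
      2F → trans s₂≈0 (trans (0≈a*0+b*0 _ _) (sym (at s 2F)))
      3F → trans s₃≈0 (trans (0≈a*0+b*0 _ _) (sym (at s 3F)))
    where
    open import Level using (lift)

    0≈a*0+b*0 : ∀ a b → 0# ≈ a * 0# + b * 0#
    0≈a*0+b*0 = solve 2 (λ a b → con (+ 0) := a :* con (+ 0) :+ b :* con (+ 0)) refl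

    at : ∀ s i → coords s 0F * (coords O ⋆ reversal) i + coords s 1F * (coords E₂ ⋆ reversal) i ≈
                 coords s 0F * 𝟏 0F i + coords s 1F * 𝟏 1F i
    at s i = +-cong (*-congˡ (𝟏-row 3F reversal i)) (*-congˡ (𝟏-row 2F reversal i))

    vanish : ∀ {a b} {x : Coords} → x ≋ a *ᵛ (coords O ⋆ reversal) +ᵛ b *ᵛ (coords E₂ ⋆ reversal) →
             ∀ i → reversal 3F i ≈ 0# → reversal 2F i ≈ 0# → x i ≈ 0#
    vanish x≋ i e f = trans (x≋ i) (trans (+-cong
      (trans (*-congˡ (trans (𝟏-row 3F reversal i) e)) (zeroʳ _))
      (trans (*-congˡ (trans (𝟏-row 2F reversal i) f)) (zeroʳ _))) (+-identityˡ 0#))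

  -- Osculating planes and their contact with the cubic.

  -- The plane x₀ = 0 osculates at P₀ and `B t` carries it to `π-osc t`, so the first coordinate
  -- after pulling back is an equation of that plane, uniformly in t. For finite t, the coefficients
  -- 1, -3t, 3t², -t³ are the first column of the inverse translation.
  osc-form : Parameter → Coords → Carrier
  osc-form t x = (x ⋆ matrix⁻¹ (B t)) 0F

  private
    osc-eq : ∀ t x → sum (λ i → (1# ∷ - (3 · t) ∷ 3 · t ^ 2 ∷ - (t ^ 3) ∷ []) i * x i) ≈ osc-form (fin t) x
    osc-eq t x = solve 5 (λ t x y z w →
      con (+ 1) :* x :+ (:- S.translation t 1F 0F :* y :+
        (S.translation t 2F 0F :* z :+ (:- (t :^ 3) :* w :+ con (+ 0)))) :=
      ((x ∷ y ∷ z ∷ w ∷ []) ⊙ S.translation (:- t)) 0F) refl t (x 0F) (x 1F) (x 2F) (x 3F)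

    osc-eq-∞ : ∀ x → sum (λ i → (0# ∷ 0# ∷ 0# ∷ 1# ∷ []) i * x i) ≈ osc-form ∞ x
    osc-eq-∞ x = solve 4 (λ x y z w →
      con (+ 0) :* x :+ (con (+ 0) :* y :+ (con (+ 0) :* z :+ (con (+ 1) :* w :+ con (+ 0)))) :=
      ((x ∷ y ∷ z ∷ w ∷ []) ⊙ S.reversal) 0F) refl (x 0F) (x 1F) (x 2F) (x 3F)

  π-osc⇒form≈0 : ∀ t p → p ∈ π-osc t → osc-form t (coords p) ≈ 0#
  π-osc⇒form≈0 (fin t) p p∈π = trans (sym (osc-eq t (coords p))) p∈π
  π-osc⇒form≈0 ∞       p p∈π = trans (sym (osc-eq-∞ (coords p))) p∈π

  form≈0⇒π-osc : ∀ t p → osc-form t (coords p) ≈ 0# → p ∈ π-osc t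
  form≈0⇒π-osc (fin t) p form≈0 = trans (osc-eq t (coords p)) form≈0
  form≈0⇒π-osc ∞       p form≈0 = trans (osc-eq-∞ (coords p)) form≈0

  osc-form-cong : ∀ t {x y} → x ∝ y → osc-form t y ≈ 0# → osc-form t x ≈ 0#
  osc-form-cong t {x} {y} (k , _ , x≋ky) y≈0 =
    trans (⋆-congˡ (matrix⁻¹ (B t)) x≋ky 0F)
      (trans (⋆-*ᵛ k y (matrix⁻¹ (B t)) 0F) (trans (*-congˡ y≈0) (zeroʳ k)))

  private
    -- Pulling back turns P_u into the point with parameter u - t, whose first coordinate is the
    -- cube (u - t)³.
    contact-parameter : ∀ u t → osc-form (fin t) (coords (cubicPoint (fin u))) ≈ 0# → u - t ≈ 0#
    contact-parameter u t form≈0 with (u - t) ≈? 0#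
    ... | yes u-t≈0 = u-t≈0
    ... | no  u-t≉0 = contradiction (trans (sym (translation-shifts (- t) u 0F)) form≈0) (^3-≉0 u-t≉0)

    no-contact-∞ : ∀ t → osc-form (fin t) (coords (cubicPoint ∞)) ≉ 0#
    no-contact-∞ t form≈0 = 1≉0 (trans (sym (𝟏-row 0F (translation (- t)) 0F)) form≈0)

    no-contact-fin : ∀ u → osc-form ∞ (coords (cubicPoint (fin u))) ≉ 0#
    no-contact-fin u form≈0 = 1≉0 (trans (sym (⋆-reversal (coords (cubicPoint (fin u))) 0F)) form≈0)

  contact-unique : ∀ u t → osc-form t (coords (cubicPoint u)) ≈ 0# → cubicPoint u ∼ cubicPoint t
  contact-unique (fin u) (fin t) form≈0 =
    ≋⇒∝ (cubicPoint-cong (x∙y⁻¹≈ε⇒x≈y u t (contact-parameter u t form≈0)))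
    where open import Algebra.Properties.AbelianGroup +-abelianGroup using (x∙y⁻¹≈ε⇒x≈y)
  contact-unique (fin u) ∞       form≈0 = contradiction form≈0 (no-contact-fin u)
  contact-unique ∞       (fin t) form≈0 = contradiction form≈0 (no-contact-∞ t)
  contact-unique ∞       ∞       form≈0 = ∝-refl

  -- The contact points agree, so `B u` and the inverse of `B t` cancel and `E₂` comes back
  -- unchanged. The two coordinates kept are those that separate the tangent from the images of
  -- `ℓ₀`.
  contact-tangent : ∀ u t → osc-form t (coords (cubicPoint u)) ≈ 0# →
                    let x = coords E₂ ⋆ matrix (B u) ⋆ matrix⁻¹ (B t) in x 1F ≈ 0# × x 2F ≉ 0#
  contact-tangent (fin u) (fin t) form≈0 =
    trans (x≋ 1F) (trans (+-cong s≈0 (trans (+-identityʳ _) s≈0)) (+-identityˡ 0#)) ,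
    λ x₂≈0 → 1≉0 (trans (sym (x≋ 2F)) x₂≈0)
    where
    s≈0 = contact-parameter u t form≈0
    x≋ : 𝟏 2F ⋆ translation u ⋆ translation (- t) ≋ translation (u - t) 2F
    x≋ = ≋-trans (⋆-translation-+ u (- t) (𝟏 2F)) (𝟏-row 2F (translation (u - t)))
  contact-tangent (fin u) ∞       form≈0 = contradiction form≈0 (no-contact-fin u)
  contact-tangent ∞       (fin t) form≈0 = contradiction form≈0 (no-contact-∞ t)
  contact-tangent ∞       ∞       form≈0 =
    leftInv J (𝟏 2F) 1F , λ x₂≈0 → 1≉0 (trans (sym (leftInv J (𝟏 2F) 2F)) x₂≈0)

-- Factorisation of every projectivity preserving the cubic.

module Classification {c ℓ : Level} {n : ℕ} (F : FiniteField c ℓ (suc n)) (4≤n : 4 ≤ n) where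

  open FiniteField F
  open TwistedCubic F
  open FieldProperties F
  open Projectivities F
  open CubicGroup F
  open IntegerCoefficients commutativeRing
  open VectorEquality setoid using (_≋_; ≋-sym; ≋-trans)
  open import Algebra.Properties.AbelianGroup +-abelianGroup using (x≈y⇒x∙y⁻¹≈ε; x∙y⁻¹≈ε⇒x≈y)
  open import Data.Integer.Base using (+_)
  open import Relation.Binary.Reasoning.Setoid setoid

  private
    01-equation 12-equation : Coords → Set ℓ
    01-equation x = x 0F * x 2F ≈ x 1F * x 1F
    12-equation x = x 1F * x 3F ≈ x 2F * x 2F

    drop-0ʳ : ∀ {x y} → y ≈ 0# → x + y ≈ x
    drop-0ʳ y≈0 = trans (+-congˡ y≈0) (+-identityʳ _)

    drop-0ˡ : ∀ {x y} → x ≈ 0# → x + y ≈ y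
    drop-0ˡ x≈0 = trans (+-congʳ x≈0) (+-identityˡ _)

    0≈0*0 : ∀ {x y z} → x ≈ 0# → z ≈ 0# → x ≈ y * z
    0≈0*0 x≈0 z≈0 = trans x≈0 (sym (trans (*-congˡ z≈0) (zeroʳ _)))

    *-0ʳ : ∀ {x y} → y ≈ 0# → x * y ≈ 0#
    *-0ʳ y≈0 = trans (*-congˡ y≈0) (zeroʳ _)

    *-0ˡ : ∀ {x y} → x ≈ 0# → x * y ≈ 0#
    *-0ˡ x≈0 = trans (*-congʳ x≈0) (zeroˡ _)

  cubic-equations : ∀ p → p ∈ 𝒞 → 01-equation (coords p) × 12-equation (coords p)
  cubic-equations p (fin t , k , _ , p≋) =
    trans (*-cong (p≋ 0F) (p≋ 2F)) (trans
      (solve 2 (λ k t → k :* t :^ 3 :* (k :* t) := k :* t :^ 2 :* (k :* t :^ 2)) refl k t)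
      (sym (*-cong (p≋ 1F) (p≋ 1F)))) ,
    trans (*-cong (p≋ 1F) (p≋ 3F)) (trans
      (solve 2 (λ k t → k :* t :^ 2 :* (k :* con (+ 1)) := k :* t :* (k :* t)) refl k t)
      (sym (*-cong (p≋ 2F) (p≋ 2F))))
  cubic-equations p (∞ , k , _ , p≋) =
    trans (*-0ʳ (0-at 2F refl)) (sym (*-0ʳ (0-at 1F refl))) ,
    trans (*-0ʳ (0-at 3F refl)) (sym (*-0ʳ (0-at 2F refl)))
    where
    0-at : ∀ i → coords (cubicPoint ∞) i ≈ 0# → coords p i ≈ 0#
    0-at i x≈0 = trans (p≋ i) (*-0ʳ x≈0)

  -- The two quadrics x₀x₂ = x₁² and x₁x₃ = x₂² pulled back along g are divisible by
  -- t² and t on the cubic, which leaves cubics in t vanishing at the q - 1 ≥ 4 units.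
  fixes-O-∞⇒diagonal : ∀ g → image g 𝒞 ≐ 𝒞 → apply g O ∼ O → apply g (cubicPoint ∞) ∼ cubicPoint ∞ →
                       ∃[ d ] d ≉ 0# × matrix g ∼ᴹ diagonal d
  fixes-O-∞⇒diagonal g (g𝒞⊆𝒞 , _) (w′ , w′≉0 , O⋆M≋) (a′ , a′≉0 , ∞⋆M≋) =
    d , d≉0 , a , a≉0 , λ where
      0F 0F → sym (*-identityʳ a)
      0F 1F → 0≈0*0 (row₀ 1F refl) refl
      0F 2F → 0≈0*0 (row₀ 2F refl) refl
      0F 3F → 0≈0*0 (row₀ 3F refl) refl
      1F 0F → 0≈0*0 b≈0 refl
      1F 1F → f≈ad
      1F 2F → 0≈0*0 h≈0 refl
      1F 3F → 0≈0*0 p≈0 refl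
      2F 0F → 0≈0*0 e≈0 refl
      2F 1F → 0≈0*0 γ≈0 refl
      2F 2F → m≈ad²
      2F 3F → 0≈0*0 r≈0 refl
      3F 0F → 0≈0*0 (row₃ 0F refl) refl
      3F 1F → 0≈0*0 (row₃ 1F refl) refl
      3F 2F → 0≈0*0 (row₃ 2F refl) refl
      3F 3F → w≈ad³
    where
    M = matrix g
    a = M 0F 0F
    b = M 1F 0F
    e = M 2F 0F
    f = M 1F 1F
    γ = M 2F 1F
    h = M 1F 2F
    m = M 2F 2F
    p = M 1F 3F
    r = M 2F 3F
    w = M 3F 3F

    row₀ : ∀ i → 𝟏 0F i ≈ 0# → M 0F i ≈ 0#
    row₀ i δ≈0 = trans (sym (𝟏-row 0F M i)) (trans (∞⋆M≋ i) (*-0ʳ δ≈0))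

    row₃ : ∀ i → 𝟏 3F i ≈ 0# → M 3F i ≈ 0#
    row₃ i δ≈0 = trans (sym (𝟏-row 3F M i)) (trans (O⋆M≋ i) (*-0ʳ δ≈0))

    a≉0 : a ≉ 0#
    a≉0 a≈0 = a′≉0 (begin
      a′                 ≈⟨ *-identityʳ a′ ⟨
      a′ * 1#            ≈⟨ ∞⋆M≋ 0F ⟨
      (𝟏 0F ⋆ M) 0F      ≈⟨ 𝟏-row 0F M 0F ⟩
      a                  ≈⟨ a≈0 ⟩
      0#                 ∎)

    w≉0 : w ≉ 0#
    w≉0 w≈0 = w′≉0 (begin
      w′                 ≈⟨ *-identityʳ w′ ⟨
      w′ * 1#            ≈⟨ O⋆M≋ 3F ⟨
      (𝟏 3F ⋆ M) 3F      ≈⟨ 𝟏-row 3F M 3F ⟩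
      w                  ≈⟨ w≈0 ⟩
      0#                 ∎)

    module _ (t : Carrier) where

      y : Coords
      y = coords (cubicPoint (fin t)) ⋆ M

      y-on-cubic : 01-equation y × 12-equation y
      y-on-cubic = cubic-equations (apply g (cubicPoint (fin t)))
        (g𝒞⊆𝒞 {apply g (cubicPoint (fin t))} (cubicPoint (fin t) , (fin t , ∝-refl) , ∝-refl))

      split : ∀ i → y i ≈ t * (M 2F i + t * M 1F i) + t ^ 3 * M 0F i + M 3F i
      split i = solve 5 (λ t m₀ m₁ m₂ m₃ →
        t :^ 3 :* m₀ :+ (t :^ 2 :* m₁ :+ (t :* m₂ :+ (con (+ 1) :* m₃ :+ con (+ 0)))) :=
        t :* (m₂ :+ t :* m₁) :+ t :^ 3 :* m₀ :+ m₃) refl t (M 0F i) (M 1F i) (M 2F i) (M 3F i)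

      y₀≈ : y 0F ≈ t * (e + t * (b + t * a))
      y₀≈ = trans (split 0F) (trans (drop-0ʳ (row₃ 0F refl))
        (solve 4 (λ t a b e → t :* (e :+ t :* b) :+ t :^ 3 :* a :=
                              t :* (e :+ t :* (b :+ t :* a))) refl t a b e))

      y₁≈ : y 1F ≈ t * (γ + t * f)
      y₁≈ = trans (split 1F) (trans (drop-0ʳ (row₃ 1F refl)) (drop-0ʳ (*-0ʳ (row₀ 1F refl))))

      y₂≈ : y 2F ≈ t * (m + t * h)
      y₂≈ = trans (split 2F) (trans (drop-0ʳ (row₃ 2F refl)) (drop-0ʳ (*-0ʳ (row₀ 2F refl))))

      y₃≈ : y 3F ≈ w + t * (r + t * p)
      y₃≈ = trans (split 3F) (trans (+-congʳ (drop-0ʳ (*-0ʳ (row₀ 3F refl)))) (+-comm _ _))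

      01-cubic : t ≉ 0# →
        e * m - γ * γ +
          t * (b * m + e * h - (γ * f + γ * f) + t * (a * m + b * h - f * f + t * (a * h))) ≈ 0#
      01-cubic t≉0 = x≉0∧xy≈0⇒y≈0 t≉0 $ x≉0∧xy≈0⇒y≈0 t≉0 $ begin
        t * (t * (e * m - γ * γ +
          t * (b * m + e * h - (γ * f + γ * f) + t * (a * m + b * h - f * f + t * (a * h)))))
          ≈⟨ solve 8 (λ t a b e f γ h m →
               t :* (t :* (e :* m :- γ :* γ :+ t :* (b :* m :+ e :* h :- (γ :* f :+ γ :* f) :+
                 t :* (a :* m :+ b :* h :- f :* f :+ t :* (a :* h))))) :=
               t :* (e :+ t :* (b :+ t :* a)) :* (t :* (m :+ t :* h)) :-
               t :* (γ :+ t :* f) :* (t :* (γ :+ t :* f)))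
               refl t a b e f γ h m ⟩
        t * (e + t * (b + t * a)) * (t * (m + t * h)) - t * (γ + t * f) * (t * (γ + t * f))
          ≈⟨ +-cong (*-cong y₀≈ y₂≈) (-‿cong (*-cong y₁≈ y₁≈)) ⟨
        y 0F * y 2F - y 1F * y 1F
          ≈⟨ x≈y⇒x∙y⁻¹≈ε (proj₁ y-on-cubic) ⟩
        0# ∎

      -- With h = 0 the coordinate y₂ is just t m, so its square contributes m² to the linear
      -- coefficient alone.
      12-cubic : h ≈ 0# → t ≉ 0# →
        γ * w + t * (γ * r + f * w - m * m + t * (γ * p + f * r + t * (f * p))) ≈ 0#
      12-cubic h≈0 t≉0 = x≉0∧xy≈0⇒y≈0 t≉0 $ begin
        t * (γ * w + t * (γ * r + f * w - m * m + t * (γ * p + f * r + t * (f * p))))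
          ≈⟨ solve 7 (λ t f γ m p r w →
               t :* (γ :* w :+ t :* (γ :* r :+ f :* w :- m :* m :+
                 t :* (γ :* p :+ f :* r :+ t :* (f :* p)))) :=
               t :* (γ :+ t :* f) :* (w :+ t :* (r :+ t :* p)) :- t :* m :* (t :* m))
               refl t f γ m p r w ⟩
        t * (γ + t * f) * (w + t * (r + t * p)) - t * m * (t * m)
          ≈⟨ +-cong (*-cong y₁≈ y₃≈) (-‿cong (*-cong y₂≈tm y₂≈tm)) ⟨
        y 1F * y 3F - y 2F * y 2F
          ≈⟨ x≈y⇒x∙y⁻¹≈ε (proj₂ y-on-cubic) ⟩
        0# ∎
        where
        y₂≈tm : y 2F ≈ t * m
        y₂≈tm = trans y₂≈ (*-congˡ (drop-0ʳ (*-0ʳ h≈0)))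

    01-coefficients = cubic-zero 4≤n _ _ _ _ 01-cubic

    -- The order of elimination matters: a h = 0 gives h = 0, then γ w = 0 gives γ = 0. Only then do
    -- the middle coefficients reduce to a m = f² and f w = m².
    h≈0 : h ≈ 0#
    h≈0 = x≉0∧xy≈0⇒y≈0 a≉0 (proj₂ (proj₂ (proj₂ 01-coefficients)))

    12-coefficients = cubic-zero 4≤n _ _ _ _ λ t → 12-cubic t h≈0

    γ≈0 : γ ≈ 0#
    γ≈0 = xy≈0∧y≉0⇒x≈0 (proj₁ 12-coefficients) w≉0

    am≈ff : a * m ≈ f * f
    am≈ff = trans (sym (drop-0ʳ (*-0ʳ h≈0))) (x∙y⁻¹≈ε⇒x≈y _ _ (proj₁ (proj₂ (proj₂ 01-coefficients))))

    fw≈mm : f * w ≈ m * m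
    fw≈mm = trans (sym (drop-0ˡ (*-0ˡ γ≈0))) (x∙y⁻¹≈ε⇒x≈y _ _ (proj₁ (proj₂ 12-coefficients)))

    -- If f were zero, the whole second column of `M` would vanish, and no vector could be mapped to
    -- `𝟏 1F`.
    f≉0 : f ≉ 0#
    f≉0 f≈0 = 1≉0 (begin
      1#                               ≈⟨ rightInv g (𝟏 1F) 1F ⟨
      (z ⋆ M) 1F                       ≈⟨ +-cong (*-0ʳ (row₀ 1F refl)) (+-cong (*-0ʳ f≈0)
                                            (+-cong (*-0ʳ γ≈0) (+-congʳ (*-0ʳ (row₃ 1F refl))))) ⟩
      0# + (0# + (0# + (0# + 0#)))     ≈⟨ drop-0ˡ refl ⟩
      0# + (0# + (0# + 0#))            ≈⟨ drop-0ˡ refl ⟩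
      0# + (0# + 0#)                   ≈⟨ drop-0ˡ refl ⟩
      0# + 0#                          ≈⟨ drop-0ˡ refl ⟩
      0#                               ∎)
      where z = 𝟏 1F ⋆ matrix⁻¹ g

    m≉0 : m ≉ 0#
    m≉0 m≈0 = *-≉0 f≉0 w≉0 (trans fw≈mm (*-0ʳ m≈0))

    b≈0 : b ≈ 0#
    b≈0 = xy≈0∧y≉0⇒x≈0 (begin
      b * m                                   ≈⟨ drop-0ʳ (*-0ʳ h≈0) ⟨
      b * m + e * h                           ≈⟨ x∙y⁻¹≈ε⇒x≈y _ _ (proj₁ (proj₂ 01-coefficients)) ⟩
      γ * f + γ * f                           ≈⟨ drop-0ʳ (*-0ˡ γ≈0) ⟩
      γ * f                                   ≈⟨ *-0ˡ γ≈0 ⟩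
      0#                                      ∎) m≉0

    e≈0 : e ≈ 0#
    e≈0 = xy≈0∧y≉0⇒x≈0 (trans (x∙y⁻¹≈ε⇒x≈y _ _ (proj₁ 01-coefficients)) (*-0ˡ γ≈0)) m≉0

    p≈0 : p ≈ 0#
    p≈0 = x≉0∧xy≈0⇒y≈0 f≉0 (proj₂ (proj₂ (proj₂ 12-coefficients)))

    r≈0 : r ≈ 0#
    r≈0 = x≉0∧xy≈0⇒y≈0 f≉0 (trans (sym (drop-0ˡ (*-0ˡ γ≈0))) (proj₁ (proj₂ (proj₂ 12-coefficients))))

    a⁻¹ = proj₁ (inverse a a≉0)
    d = a⁻¹ * f

    f≈ad : f ≈ a * d
    f≈ad = sym (trans (sym (*-assoc a a⁻¹ f)) (drop-unit (proj₂ (inverse a a≉0)) f))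

    d≉0 : d ≉ 0#
    d≉0 d≈0 = f≉0 (trans f≈ad (*-0ʳ d≈0))

    m≈ad² : m ≈ a * d ^ 2
    m≈ad² = *-cancelˡ-≉0 a≉0 (begin
      a * m                  ≈⟨ am≈ff ⟩
      f * f                  ≈⟨ *-cong f≈ad f≈ad ⟩
      a * d * (a * d)        ≈⟨ solve 2 (λ a d → a :* d :* (a :* d) := a :* (a :* d :^ 2)) refl a d ⟩
      a * (a * d ^ 2)        ∎)

    w≈ad³ : w ≈ a * d ^ 3
    w≈ad³ = *-cancelˡ-≉0 f≉0 (begin
      f * w                        ≈⟨ fw≈mm ⟩
      m * m                        ≈⟨ *-cong m≈ad² m≈ad² ⟩
      a * d ^ 2 * (a * d ^ 2)      ≈⟨ solve 2 (λ a d → a :* d :^ 2 :* (a :* d :^ 2) :=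
                                                     a :* d :* (a :* d :^ 3)) refl a d ⟩
      a * d * (a * d ^ 3)          ≈⟨ *-congʳ f≈ad ⟨
      f * (a * d ^ 3)              ∎)

  -- `U c` fixes P₀, so t alone decides the image of P₀, and c is left free to adjust the image of
  -- P_∞.
  K : Parameter → Carrier → Projectivity
  K t c = U c ∙ B t

  K∈G : ∀ t c → image (K t c) 𝒞 ≐ 𝒞
  K∈G t c = image-∙ (U c) (B t) (U∈G c) (B∈G t)

  ⋆-K : ∀ t c x → x ⋆ matrix (K t c) ≋ x ⋆ matrix (U c) ⋆ matrix (B t)
  ⋆-K t c x = ≋-sym (⋆-assoc x (matrix (U c)) (matrix (B t)))

  O⋆K : ∀ t c → coords O ⋆ matrix (K t c) ≋ coords (cubicPoint t)
  O⋆K t c = ≋-trans (⋆-K t c (coords O)) (≋-trans (⋆-congˡ (matrix (B t)) (O⋆U c)) (O⋆B t))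

  -- Pulled back by `B t`, the point P_u becomes some P_v other than P₀. `U c` sends P_∞ to P_v for
  -- c = 1 / v, or for c = 0 when v is infinite.
  two-transitive : ∀ t u → ¬ (cubicPoint u ∼ cubicPoint t) →
                   ∃[ c ] cubicPoint u ∼ apply (K t c) (cubicPoint ∞)
  two-transitive t u Pu≁Pt =
    let v , PuB⁻¹∼Pv = proj₁ (image-⁻¹ (B t) (λ {x} {y} → 𝒞-resp {x} {y}) (B∈G t))
                         {apply (B t ⁻¹) (cubicPoint u)} (cubicPoint u , (u , ∝-refl) , ∝-refl)
        c , Pv∼∞U = go v PuB⁻¹∼Pv
    in c , ∝-trans (lift-B PuB⁻¹∼Pv) (∝-trans (∝-⋆ (matrix (B t)) Pv∼∞U) (∝-sym (≋⇒∝ (⋆-K t c (𝟏 0F)))))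
    where
    lift-B : ∀ {x} → coords (cubicPoint u) ⋆ matrix⁻¹ (B t) ∝ x → coords (cubicPoint u) ∝ x ⋆ matrix (B t)
    lift-B eq = ∝-trans (∝-sym (apply-⁻¹ (B t ⁻¹) (cubicPoint u))) (∝-⋆ (matrix (B t)) eq)

    go : ∀ v → apply (B t ⁻¹) (cubicPoint u) ∼ cubicPoint v →
         ∃[ c ] coords (cubicPoint v) ∝ coords (cubicPoint ∞) ⋆ matrix (U c)
    go ∞       _ = 0# , ∝-sym (≋⇒∝ (⋆-U-0 refl (𝟏 0F)))
    go (fin v) PuB⁻¹∼Pv with v ≈? 0#
    ... | yes v≈0 = contradiction
      (∝-trans (lift-B (∝-trans PuB⁻¹∼Pv (≋⇒∝ (P₀≋O v≈0)))) (≋⇒∝ (O⋆B t))) Pu≁Pt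
    ... | no  v≉0 = let s , vs≈1 = inverse v v≉0 in
      s , ∝-sym (∝-trans (≋⇒∝ (∞⋆U s)) (reverse-cubicPoint (trans (*-comm s v) vs≈1)))

  classification : ∀ g → image g 𝒞 ≐ 𝒞 → ∃[ t ] ∃[ c ] ∃[ d ] Σ (d ≉ 0#) λ d≉0 → g ≃ D d d≉0 ∙ K t c
  classification g g𝒞≐𝒞@(g𝒞⊆𝒞 , _) =
    t , s , d , d≉0 ,
    ∼ᴹ-trans (∼ᴹ-sym (//-rightDividesˡ (K t s) g))
             (∙-cong {h} {D d d≉0} {K t s} {K t s} h≃D (∼ᴹ-refl {matrix (K t s)}))
    where
    open import Algebra.Properties.Group PGL using (//-rightDividesˡ)
    gO∈𝒞 : apply g O ∈ 𝒞
    gO∈𝒞 = g𝒞⊆𝒞 {apply g O} (O , (fin 0# , ≋⇒∝ (≋-sym (P₀≋O refl))) , ∝-refl)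
    g∞∈𝒞 : apply g (cubicPoint ∞) ∈ 𝒞
    g∞∈𝒞 = g𝒞⊆𝒞 {apply g (cubicPoint ∞)} (cubicPoint ∞ , (∞ , ∝-refl) , ∝-refl)
    t = proj₁ gO∈𝒞
    u = proj₁ g∞∈𝒞

    Pu≁Pt : ¬ (cubicPoint u ∼ cubicPoint t)
    Pu≁Pt Pu∼Pt =
      let k , _ , ∞≋kO = apply-injective g (cubicPoint ∞) O
                           (∝-trans (proj₂ g∞∈𝒞) (∝-trans Pu∼Pt (∝-sym (proj₂ gO∈𝒞))))
      in 1≉0 (trans (∞≋kO 0F) (zeroʳ k))

    s = proj₁ (two-transitive t u Pu≁Pt)
    h = g ∙ K t s ⁻¹

    hO∼O : apply h O ∼ O
    hO∼O = ∝-trans (apply-∙ g (K t s ⁻¹) O) $ apply-transpose (K t s) (apply g O) O $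
      ∝-trans (proj₂ gO∈𝒞) (≋⇒∝ (≋-sym (O⋆K t s)))

    h∞∼∞ : apply h (cubicPoint ∞) ∼ cubicPoint ∞
    h∞∼∞ = ∝-trans (apply-∙ g (K t s ⁻¹) (cubicPoint ∞)) $
      apply-transpose (K t s) (apply g (cubicPoint ∞)) (cubicPoint ∞) $
      ∝-trans (proj₂ g∞∈𝒞) (proj₂ (two-transitive t u Pu≁Pt))

    h-diagonal = fixes-O-∞⇒diagonal h
      (image-∙ g (K t s ⁻¹) g𝒞≐𝒞 (image-⁻¹ (K t s) (λ {x} {y} → 𝒞-resp {x} {y}) (K∈G t s)))
      hO∼O h∞∼∞
    d   = proj₁ h-diagonal
    d≉0 = proj₁ (proj₂ h-diagonal)
    h≃D : h ≃ D d d≉0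
    h≃D = proj₂ (proj₂ h-diagonal)

module Conjugation {a ℓ} (G : Group a ℓ) where

  open Group G
  open import Relation.Binary.Reasoning.Setoid setoid
  open import Algebra.Properties.Group G using (\\-leftDividesˡ; //-rightDividesʳ)

  -- Used with k and again with k⁻¹ in its place, for the two directions of the bijection between
  -- stabilisers and units.
  conjugate-cancel : ∀ k x → k ∙ (k ⁻¹ ∙ x ∙ k) ∙ k ⁻¹ ≈ x
  conjugate-cancel k x = begin
    k ∙ (k ⁻¹ ∙ x ∙ k) ∙ k ⁻¹       ≈⟨ ∙-congʳ (∙-congˡ (assoc _ _ _)) ⟩
    k ∙ (k ⁻¹ ∙ (x ∙ k)) ∙ k ⁻¹     ≈⟨ ∙-congʳ (\\-leftDividesˡ k (x ∙ k)) ⟩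
    x ∙ k ∙ k ⁻¹                    ≈⟨ //-rightDividesʳ k x ⟩
    x                               ∎

-- UΓ-lines as the images of `ℓ₀`.

module UnisecantLines {c ℓ : Level} {n : ℕ} (F : FiniteField c ℓ (suc n)) (4≤n : 4 ≤ n)
             (q-odd : ¬ (2 ∣ suc n)) where

  open FiniteField F
  open TwistedCubic F
  open FieldProperties F
  open Projectivities F
  open CubicGroup F
  open Classification F 4≤n
  open IntegerCoefficients commutativeRing
  open import Data.Vec.Functional using ([]; _∷_)
  open VectorEquality setoid using (_≋_; ≋-sym; ≋-trans)
  open import Data.Integer.Base using (+_)
  open import Relation.Binary.Reasoning.Setoid setoid

  private
    2≉0 : 1# + 1# ≉ 0#
    2≉0 = 1+1≉0 q-odd

    a*0+b*0≈0 : ∀ a b → a * 0# + b * 0# ≈ 0#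
    a*0+b*0≈0 = solve 2 (λ a b → a :* con (+ 0) :+ b :* con (+ 0) := con (+ 0)) refl

    a*0+b*1≈b : ∀ a b → a * 0# + b * 1# ≈ b
    a*0+b*1≈b = solve 2 (λ a b → a :* con (+ 0) :+ b :* con (+ 1) := b) refl

    double : ∀ x → 2 · x ≈ (1# + 1#) * x
    double = solve 1 (λ x → x :+ (x :+ con (+ 0)) := (con (+ 1) :+ con (+ 1)) :* x) refl

  line-resp : ∀ l → ⟦ l ⟧ Respects _∼_
  line-resp l {x} {y} = join-resp (Line.p₁ l) (Line.p₂ l) {x} {y}

  -- Pulled back by `B t`, the line is the image of `ℓ₀` under `U u`; in these coordinates
  -- membership in planes and tangency can be read off.
  K-image : ∀ t u l → image (K t u) ⟦ ℓ₀ ⟧ ≐ ⟦ l ⟧ → ∀ s → s ∈ ⟦ l ⟧ →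
            ∃[ α ] ∃[ β ] coords s ⋆ matrix⁻¹ (B t) ∝
                          α *ᵛ coords O +ᵛ β *ᵛ (0# ∷ 1# ∷ 2 · u ∷ 3 · u ^ 2 ∷ [])
  K-image t u l (_ , l⊆Kℓ₀) s s∈l = let x , (α , β , x≋) , s∼Kx = l⊆Kℓ₀ {s} s∈l in
    α , β , ∝-trans
      (∝-trans (∝-⋆ (matrix⁻¹ (B t)) (∝-trans s∼Kx (≋⇒∝ (⋆-K t u (coords x)))))
               (≋⇒∝ (leftInv (B t) (coords x ⋆ matrix (U u)))))
      (≋⇒∝ (≋-trans (⋆-congˡ (matrix (U u)) x≋)
        (≋-trans (⋆-linear α β (coords O) (coords E) (matrix (U u))) λ i → +-cong (*-congˡ (O⋆U u i)) (*-congˡ (E⋆U u i)))))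

  -- The pulled-back points have first coordinate zero, so l lies in the osculating plane at P_t,
  -- and P_t is the only point of the cubic in that plane.
  K-image⇒UΓ : ∀ t u l → image (K t u) ⟦ ℓ₀ ⟧ ≐ ⟦ l ⟧ → UΓ l
  K-image⇒UΓ t u l Kℓ₀≐l@(Kℓ₀⊆l , _) =
    (KO , ((t , KO∼Pt) , KO∈l) , unique) , not-tangent , t , λ {s} s∈l → form≈0⇒π-osc t s (l⊆π s s∈l)
    where
    KO : Point
    KO = apply (K t u) O

    KO∼Pt : KO ∼ cubicPoint t
    KO∼Pt = ≋⇒∝ (O⋆K t u)

    KO∈l : KO ∈ ⟦ l ⟧
    KO∈l = Kℓ₀⊆l {KO} (O , p∈join O E , ∝-refl)

    l⊆π : ∀ s → s ∈ ⟦ l ⟧ → osc-form t (coords s) ≈ 0#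
    l⊆π s s∈l = let α , β , k , _ , sB⁻¹≋ = K-image t u l Kℓ₀≐l s s∈l in
      trans (sB⁻¹≋ 0F) (trans (*-congˡ (a*0+b*0≈0 α β)) (zeroʳ k))

    unique : ∀ r → r ∈ 𝒞 → r ∈ ⟦ l ⟧ → r ∼ KO
    unique r (s , r∼Ps) r∈l = ∝-trans r∼Ps $
      ∝-trans (contact-unique s t (osc-form-cong t (∝-sym r∼Ps) (l⊆π r r∈l))) (∝-sym KO∼Pt)

    -- A tangent within this plane has contact point P_t, so its pullback contains a point with
    -- second coordinate zero and third nonzero. On the pullback of l these coordinates are
    -- multiples of β and 2uβ, so the third vanishes with the second.
    not-tangent : ¬ IsTangent l
    not-tangent (s , _ , tangent⊆l) = x₂≉0 x₂≈0
      where
      B⊆l : ∀ x → x ∈ join O E₂ → apply (B s) x ∈ ⟦ l ⟧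
      B⊆l x x∈ = tangent⊆l {apply (B s) x} (proj₁ (B-tangent s) {apply (B s) x} (x , x∈ , ∝-refl))

      contact = contact-tangent s t (osc-form-cong t (≋⇒∝ (≋-sym (O⋆B s)))
        (l⊆π (apply (B s) O) (B⊆l O (p∈join O E₂))))
      x₁≈0 = proj₁ contact
      x₂≉0 = proj₂ contact

      x₂≈0 : (coords E₂ ⋆ matrix (B s) ⋆ matrix⁻¹ (B t)) 2F ≈ 0#
      x₂≈0 =
        let α , β , k , k≉0 , x≋ = K-image t u l Kℓ₀≐l (apply (B s) E₂) (B⊆l E₂ (r∈join O E₂))
            β≈0 = trans (sym (a*0+b*1≈b α β)) (x≉0∧xy≈0⇒y≈0 k≉0 (trans (sym (x≋ 1F)) x₁≈0))
        in trans (x≋ 2F) (trans (*-congˡ (trans (+-congˡ (*-congʳ β≈0))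
          (solve 2 (λ α c → α :* con (+ 0) :+ con (+ 0) :* c := con (+ 0)) refl α (2 · u)))) (zeroʳ k))

  -- The point of l on the cubic must be the contact point P_t of the plane holding l. Pulling back
  -- by `B t` gives a line joining `O` to some (0, y, z, w), and it remains to choose u.
  UΓ⇒K-image : ∀ l → UΓ l → ∃[ t ] ∃[ u ] image (K t u) ⟦ ℓ₀ ⟧ ≐ ⟦ l ⟧
  UΓ⇒K-image l ((p , ((s , p∼Ps) , p∈l) , _) , not-tangent , t , l⊆π) =
    t , u , image-∙ (U u) (B t) (≐-trans (image-join (U u) O E) (≐-sym Bl≐Uℓ₀)) (B-image ≐-refl)
    where
    p∼Pt : p ∼ cubicPoint t
    p∼Pt = ∝-trans p∼Ps (contact-unique s t
      (osc-form-cong t (∝-sym p∼Ps) (π-osc⇒form≈0 t p (l⊆π {p} p∈l))))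

    r : Point
    r = proj₁ (line-through l p p∈l)

    l≐pr : ⟦ l ⟧ ≐ join p r
    l≐pr = proj₂ (line-through l p p∈l)

    p′ r′ : Point
    p′ = apply (B t ⁻¹) p
    r′ = apply (B t ⁻¹) r

    p′∼O : p′ ∼ O
    p′∼O = apply-transpose (B t) p O (∝-trans p∼Pt (≋⇒∝ (≋-sym (O⋆B t))))

    x y z w : Carrier
    x = coords r′ 0F
    y = coords r′ 1F
    z = coords r′ 2F
    w = coords r′ 3F

    x≈0 : x ≈ 0#
    x≈0 = π-osc⇒form≈0 t r (l⊆π {r} (proj₂ l≐pr {r} (r∈join p r)))

    B⁻¹l : Pred Point (c ⊔ ℓ)
    B⁻¹l = image (B t ⁻¹) ⟦ l ⟧

    Bl≐Or′ : B⁻¹l ≐ join O r′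
    Bl≐Or′ = ≐-trans (image-cong (B t ⁻¹) l≐pr)
      (≐-trans (image-join (B t ⁻¹) p r) (join-cong p′ r′ O r′ p′∼O ∝-refl))

    B-image : ∀ {S : Pred Point (c ⊔ ℓ)} → B⁻¹l ≐ S → image (B t) S ≐ ⟦ l ⟧
    B-image = image-⁻¹ (B t ⁻¹) (λ {x} {y} → line-resp l {x} {y})

    r′≁O : ¬ (r′ ∼ O)
    r′≁O r′∼O = line-not-degenerate l p r l≐pr (apply-injective (B t ⁻¹) r p (∝-trans r′∼O (∝-sym p′∼O)))

    -- With y = 0 the pulled-back line would be the tangent at P₀, and l the tangent at P_t.
    y≉0 : y ≉ 0#
    y≉0 y≈0 = not-tangent (t ,
      ≐-trans (≐-sym (B-image (≐-trans Bl≐Or′ (join-exchange O E₂ r′ w z z≉0 r′≋)))) (B-tangent t))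
      where
      r′≋ : coords r′ ≋ w *ᵛ coords O +ᵛ z *ᵛ coords E₂
      r′≋ = λ where
        0F → trans x≈0 (sym (a*0+b*0≈0 w z))
        1F → trans y≈0 (sym (a*0+b*0≈0 w z))
        2F → sym (a*0+b*1≈b w z)
        3F → solve 2 (λ w z → w := w :* con (+ 1) :+ z :* con (+ 0)) refl w z
      z≉0 : z ≉ 0#
      z≉0 z≈0 = r′≁O (multiple⇒∝ r′ w λ i → trans (r′≋ i)
        (trans (+-congˡ (trans (*-congʳ z≈0) (zeroˡ _))) (+-identityʳ _)))

    -- u solves 2yu = z, the condition for (0, y, z, w) to be y (0, 1, 2u, 3u²) up to a multiple of
    -- `O`.
    1/2y = inverse ((1# + 1#) * y) (*-≉0 2≉0 y≉0)

    u : Carrier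
    u = proj₁ 1/2y * z

    Bl≐Uℓ₀ : B⁻¹l ≐ join (apply (U u) O) (apply (U u) E)
    Bl≐Uℓ₀ = ≐-trans Bl≐Or′ $ ≐-trans
      (join-exchange O (apply (U u) E) r′ (w - y * (3 · u ^ 2)) y y≉0 λ i →
        trans (r′≋ i) (+-congˡ (*-congˡ (sym (E⋆U u i)))))
      (join-cong O (apply (U u) E) (apply (U u) O) (apply (U u) E) (≋⇒∝ (≋-sym (O⋆U u))) ∝-refl)
      where
      r′≋ : coords r′ ≋ (w - y * (3 · u ^ 2)) *ᵛ coords O +ᵛ y *ᵛ (0# ∷ 1# ∷ 2 · u ∷ 3 · u ^ 2 ∷ [])
      r′≋ = λ where
        0F → trans x≈0 (sym (a*0+b*0≈0 _ y))
        1F → sym (a*0+b*1≈b _ y)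
        2F → sym (begin
          (w - y * (3 · u ^ 2)) * 0# + y * (2 · u)   ≈⟨ +-cong (zeroʳ _) (*-congˡ (double u)) ⟩
          0# + y * ((1# + 1#) * (proj₁ 1/2y * z))    ≈⟨ solve 3 (λ y i z →
            con (+ 0) :+ y :* ((con (+ 1) :+ con (+ 1)) :* (i :* z)) :=
            (con (+ 1) :+ con (+ 1)) :* y :* i :* z)
            refl y (proj₁ 1/2y) z ⟩
          (1# + 1#) * y * proj₁ 1/2y * z             ≈⟨ drop-unit (proj₂ 1/2y) z ⟩
          z                                          ∎)
        3F → solve 3 (λ w y v → w := (w :- y :* v) :* con (+ 1) :+ y :* v) refl w y (3 · u ^ 2)

  D-fixes-ℓ₀ : ∀ d d≉0 → image (D d d≉0) ⟦ ℓ₀ ⟧ ≐ ⟦ ℓ₀ ⟧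
  D-fixes-ℓ₀ d d≉0 = ≐-trans (image-join (D d d≉0) O E) $
    join-cong (apply (D d d≉0) O) (apply (D d d≉0) E) O E
      (d ^ 3 , ^3-≉0 d≉0 , ≋-trans (⋆-diagonal d (coords O)) λ where
        0F → sym (zeroʳ _)
        1F → trans (zeroʳ _) (sym (zeroʳ _))
        2F → trans (zeroʳ _) (sym (zeroʳ _))
        3F → refl)
      (d , d≉0 , ≋-trans (⋆-diagonal d (coords E)) λ where
        0F → sym (zeroʳ _)
        1F → refl
        2F → trans (zeroʳ _) (sym (zeroʳ _))
        3F → trans (zeroʳ _) (sym (zeroʳ _)))

  K-factor : ∀ g l t u d d≉0 → g ≃ D d d≉0 ∙ K t u → image g ⟦ ℓ₀ ⟧ ≐ ⟦ l ⟧ →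
             image (K t u) ⟦ ℓ₀ ⟧ ≐ ⟦ l ⟧
  K-factor g l t u d d≉0 g≃DK gℓ₀≐l = image-∙-cancel (D d d≉0) (K t u) (D-fixes-ℓ₀ d d≉0)
    (≐-trans (image-resp {D d d≉0 ∙ K t u} {g} ⟦ ℓ₀ ⟧ (∼ᴹ-sym g≃DK)) gℓ₀≐l)

  image-of-ℓ₀⇒UΓ : ∀ g l → image g 𝒞 ≐ 𝒞 → image g ⟦ ℓ₀ ⟧ ≐ ⟦ l ⟧ → UΓ l
  image-of-ℓ₀⇒UΓ g l g𝒞≐𝒞 gℓ₀≐l = let t , u , d , d≉0 , g≃DK = classification g g𝒞≐𝒞 in
    K-image⇒UΓ t u l (K-factor g l t u d d≉0 g≃DK gℓ₀≐l)

  -- The diagonal matrix with d = 1 serves as an element of the group mapping `ℓ₀` to itself.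
  ℓ₀-UΓ : UΓ ℓ₀
  ℓ₀-UΓ = image-of-ℓ₀⇒UΓ (D 1# 1≉0) ℓ₀ (D∈G 1# 1≉0) (D-fixes-ℓ₀ 1# 1≉0)

  UΓ-orbit : IsOrbit UΓ
  UΓ-orbit = ℓ₀ , λ m → mk⇔
    (λ m∈UΓ → let t , u , Kℓ₀≐m = UΓ⇒K-image m m∈UΓ in (K t u , K∈G t u) , Kℓ₀≐m)
    (λ ((g , g𝒞≐𝒞) , gℓ₀≐m) → image-of-ℓ₀⇒UΓ g m g𝒞≐𝒞 gℓ₀≐m)

  -- `ℓ₀` is x₀ = x₂ = 0. Among the points P_t it contains only P₀, which forces t = 0; the image of
  -- `E` then has third coordinate 2u, which forces u = 0.
  K-fixes-ℓ₀ : ∀ t u → image (K t u) ⟦ ℓ₀ ⟧ ≐ ⟦ ℓ₀ ⟧ → ∀ x → x ⋆ matrix (K t u) ≋ x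
  K-fixes-ℓ₀ t u Kℓ₀≐ℓ₀ = K-trivial t Pt∈ℓ₀ EK∈ℓ₀
    where
    Pt∈ℓ₀ : cubicPoint t ∈ ⟦ ℓ₀ ⟧
    Pt∈ℓ₀ = line-resp ℓ₀ {apply (K t u) O} {cubicPoint t} (≋⇒∝ (O⋆K t u))
      (proj₁ Kℓ₀≐ℓ₀ {apply (K t u) O} (O , p∈join O E , ∝-refl))

    EK∈ℓ₀ : apply (K t u) E ∈ ⟦ ℓ₀ ⟧
    EK∈ℓ₀ = proj₁ Kℓ₀≐ℓ₀ {apply (K t u) E} (E , r∈join O E , ∝-refl)

    K-trivial : ∀ t → cubicPoint t ∈ ⟦ ℓ₀ ⟧ → apply (K t u) E ∈ ⟦ ℓ₀ ⟧ → ∀ x → x ⋆ matrix (K t u) ≋ x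
    K-trivial ∞       (a , b , ∞≋) _ = contradiction (trans (∞≋ 0F) (a*0+b*0≈0 a b)) 1≉0
    K-trivial (fin t) (a , b , Pt≋) (a′ , b′ , EK≋) x =
      ≋-trans (⋆-K (fin t) u x) (≋-trans (⋆-translation-0 t≈0 (x ⋆ matrix (U u))) (⋆-U-0 u≈0 x))
      where
      t≈0 : t ≈ 0#
      t≈0 = trans (Pt≋ 2F) (a*0+b*0≈0 a b)

      u≈0 : u ≈ 0#
      u≈0 = x≉0∧xy≈0⇒y≈0 2≉0 (begin
        (1# + 1#) * u                                        ≈⟨ double u ⟨
        2 · u                                                ≈⟨ E⋆U u 2F ⟨
        (coords E ⋆ matrix (U u)) 2F                         ≈⟨ ⋆-translation-0 t≈0 (coords E ⋆ matrix (U u)) 2F ⟨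
        (coords E ⋆ matrix (U u) ⋆ matrix (T t)) 2F          ≈⟨ ⋆-K (fin t) u (coords E) 2F ⟨
        (coords E ⋆ matrix (K (fin t) u)) 2F                 ≈⟨ EK≋ 2F ⟩
        a′ * 0# + b′ * 0#                                    ≈⟨ a*0+b*0≈0 a′ b′ ⟩
        0#                                                   ∎)

  -- Stabilisers of UΓ-lines.

  stabiliser-ℓ₀ : ∀ g → Fixes g ℓ₀ → ∃[ d ] d ≉ 0# × matrix (proj₁ g) ∼ᴹ diagonal d
  stabiliser-ℓ₀ (g , g𝒞≐𝒞) gℓ₀≐ℓ₀ = let t , u , d , d≉0 , g≃DK = classification g g𝒞≐𝒞 in
    d , d≉0 , ∼ᴹ-trans g≃DK (matrices⇒≃ λ i →
      K-fixes-ℓ₀ t u (K-factor g ℓ₀ t u d d≉0 g≃DK gℓ₀≐ℓ₀) (diagonal d i))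

  -- The first diagonal entry is 1 in both matrices, which pins the scalar to 1.
  diagonal-injective : ∀ {d e} → diagonal d ∼ᴹ diagonal e → d ≈ e
  diagonal-injective {d} {e} (k , _ , eq) = trans (eq 1F 1F) (trans (*-congʳ k≈1) (*-identityˡ e))
    where
    k≈1 : k ≈ 1#
    k≈1 = sym (trans (eq 0F 0F) (*-identityʳ k))

  diagonal-cong : ∀ {d e} → d ≈ e → diagonal d ∼ᴹ diagonal e
  diagonal-cong d≈e = matrices⇒≃ λ where
    0F _  → refl
    1F 0F → refl
    1F 1F → d≈e
    1F 2F → refl
    1F 3F → refl
    2F 0F → refl
    2F 1F → refl
    2F 2F → *-cong d≈e (*-congʳ d≈e)
    2F 3F → refl
    3F 0F → refl
    3F 1F → refl
    3F 2F → refl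
    3F 3F → *-cong d≈e (*-cong d≈e (*-congʳ d≈e))

  -- Products act from left to right on row vectors, so k g k⁻¹ takes `ℓ₀` to l, to l, and back to
  -- `ℓ₀`. It is therefore diagonal, and its parameter d is the unit assigned to g.
  stabiliser↔units : ∀ k l → image k 𝒞 ≐ 𝒞 → image k ⟦ ℓ₀ ⟧ ≐ ⟦ l ⟧ → Inverse (stabiliser l) Units
  stabiliser↔units k l k𝒞≐𝒞 kℓ₀≐l = record
    { to        = λ g → to g , proj₁ (proj₂ (spec g))
    ; from      = from
    ; to-cong   = λ {g} {h} → to-cong g h
    ; from-cong = λ {d} {e} → from-cong d e
    ; inverse   = (λ {d} {g} → to-from d g) , (λ {g} {d} → from-to g d)
    }
    where
    open Conjugation PGL
    open Setoid (stabiliser l) using () renaming (Carrier to Stab)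

    fix𝒞 : Projectivity → Set (c ⊔ ℓ)
    fix𝒞 g = image g 𝒞 ≐ 𝒞

    k⁻¹𝒞≐𝒞 : fix𝒞 (k ⁻¹)
    k⁻¹𝒞≐𝒞 = image-⁻¹ k (λ {x} {y} → 𝒞-resp {x} {y}) k𝒞≐𝒞

    k⁻¹l≐ℓ₀ : image (k ⁻¹) ⟦ l ⟧ ≐ ⟦ ℓ₀ ⟧
    k⁻¹l≐ℓ₀ = image-⁻¹ k (λ {x} {y} → line-resp ℓ₀ {x} {y}) kℓ₀≐l

    conj : Projectivity → Projectivity
    conj g = k ∙ g ∙ k ⁻¹

    conj⁻¹ : Projectivity → Projectivity
    conj⁻¹ g = k ⁻¹ ∙ g ∙ k

    spec : (g : Stab) → ∃[ d ] d ≉ 0# × matrix (conj (proj₁ (proj₁ g))) ∼ᴹ diagonal d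
    spec ((g , g𝒞≐𝒞) , gl≐l) = stabiliser-ℓ₀
      (conj g , image-∙ (k ∙ g) (k ⁻¹) (image-∙ k g k𝒞≐𝒞 g𝒞≐𝒞) k⁻¹𝒞≐𝒞)
      (image-∙ (k ∙ g) (k ⁻¹) (image-∙ k g kℓ₀≐l gl≐l) k⁻¹l≐ℓ₀)

    to : Stab → Carrier
    to g = proj₁ (spec g)

    conj≃ : ∀ g → matrix (conj (proj₁ (proj₁ g))) ∼ᴹ diagonal (to g)
    conj≃ g = proj₂ (proj₂ (spec g))

    from : Setoid.Carrier Units → Stab
    from (d , d≉0) =
      (conj⁻¹ (D d d≉0) ,
        image-∙ (k ⁻¹ ∙ D d d≉0) k (image-∙ (k ⁻¹) (D d d≉0) k⁻¹𝒞≐𝒞 (D∈G d d≉0)) k𝒞≐𝒞) ,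
      image-∙ (k ⁻¹ ∙ D d d≉0) k (image-∙ (k ⁻¹) (D d d≉0) k⁻¹l≐ℓ₀ (D-fixes-ℓ₀ d d≉0)) kℓ₀≐l

    conj-cong : ∀ k′ {g h} → g ≃ h → k′ ∙ g ∙ k′ ⁻¹ ≃ k′ ∙ h ∙ k′ ⁻¹
    conj-cong k′ {g} {h} g≃h = ∙-cong {k′ ∙ g} {k′ ∙ h} {k′ ⁻¹} {k′ ⁻¹}
      (∙-cong {k′} {k′} {g} {h} (∼ᴹ-refl {matrix k′}) g≃h) (∼ᴹ-refl {matrix⁻¹ k′})

    to-cong : ∀ g h → proj₁ (proj₁ g) ≃ proj₁ (proj₁ h) → to g ≈ to h
    to-cong g h g≃h = diagonal-injective $ ∼ᴹ-trans (∼ᴹ-sym (conj≃ g)) $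
      ∼ᴹ-trans (conj-cong k {proj₁ (proj₁ g)} {proj₁ (proj₁ h)} g≃h) (conj≃ h)

    from-cong : ∀ d e → proj₁ d ≈ proj₁ e → proj₁ (proj₁ (from d)) ≃ proj₁ (proj₁ (from e))
    from-cong (d , d≉0) (e , e≉0) d≈e =
      conj-cong (k ⁻¹) {D d d≉0} {D e e≉0} (diagonal-cong d≈e)

    to-from : ∀ d g → proj₁ (proj₁ g) ≃ proj₁ (proj₁ (from d)) → to g ≈ proj₁ d
    to-from (d , d≉0) g g≃ = diagonal-injective $ ∼ᴹ-trans (∼ᴹ-sym (conj≃ g)) $
      ∼ᴹ-trans (conj-cong k {proj₁ (proj₁ g)} {conj⁻¹ (D d d≉0)} g≃) (conjugate-cancel k (D d d≉0))

    from-to : ∀ g d → proj₁ d ≈ to g → proj₁ (proj₁ (from d)) ≃ proj₁ (proj₁ g)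
    from-to g (d , d≉0) d≈ = ∼ᴹ-trans
      (conj-cong (k ⁻¹) {D d d≉0} {conj (proj₁ (proj₁ g))} (∼ᴹ-trans (diagonal-cong d≈) (∼ᴹ-sym (conj≃ g))))
      -- The inverse of k⁻¹ is k by definition, so conjugation by k⁻¹ is `conj⁻¹`.
      (conjugate-cancel (k ⁻¹) (proj₁ (proj₁ g)))

  stabiliser-size : ∀ l → UΓ l → HasSize (stabiliser l) n
  stabiliser-size l l∈UΓ = let t , u , Kℓ₀≐l = UΓ⇒K-image l l∈UΓ in
    Composition.inverse (stabiliser↔units (K t u) l (K∈G t u) Kℓ₀≐l) units-size

theorem6p2 : {c ℓ : Level} (q : ℕ) (F : FiniteField c ℓ q) → 5 ≤ q → ¬ (2 ∣ q) →
    let open FiniteField F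
        open TwistedCubic F
    in IsOrbit UΓ
       × (∀ l → UΓ l → HasSize (stabiliser l) (q ∸ 1))
       × UΓ ℓ₀
       × (∀ g → Fixes g ℓ₀ → ∃[ d ] d ≉ 0# × matrix (proj₁ g) ∼ᴹ diagonal d)
-- Writing q as `suc n` makes q ∸ 1 compute to n, the number of units.
theorem6p2 (suc n) F (s≤s 4≤n) q-odd = UΓ-orbit , stabiliser-size , ℓ₀-UΓ , stabiliser-ℓ₀
  where open UnisecantLines F 4≤n q-odd
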